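{- Let $t\ge 1$ and $n_1,\dots,n_t\ge 1$ be integers, $n=n_1+\cdots+n_t$, and let $M$ be a real $n\times n$ matrix written in block form $M=(M_{ij})_{1\le i,j\le t}$, where $M_{ij}$ is an $n_i\times n_j$ block. Suppose that $M_{ii}=l_iJ_{n_i}+p_iI_{n_i}$ for every $i\in\{1,\dots,t\}$, and $M_{ij}=s_{ij}J_{n_i,n_j}$ for all $i\neq j$ in $\{1,\dots,t\}$, where $l_i,p_i,s_{ij}$ are real numbers. Let $B=B(M)$ be the quotient matrix of $M$. Then $$\sigma(M)=\sigma(B)\cup\{p_i^{[n_i-1]}\mid i=1,2,\dots,t\},$$ where the union is a union of multisets (eigenvalues counted with multiplicity).
   Context: $I_p$ is the $p\times p$ identity matrix, $J_{p,q}$ is the $p\times q$ all-ones matrix, and $J_p=J_{p,p}$. $\sigma(M)$ denotes the spectrum of a square matrix $M$, i.e. the multiset of its (complex) eigenvalues. $\lambda^{[m]}$ means that $\lambda$ is listed with multiplicity $m$. The quotient matrix of a block matrix $M=(M_{ij})_{1\le i,j\le t}$ (with $M_{ij}$ of size $n_i\times n_j$) is the $t\times t$ matrix $B(M)=(b_{ij})$, where $b_{ij}$ is the average row sum of $M_{ij}$, i.e. the sum of all entries of $M_{ij}$ divided by the number of its rows $n_i$. -}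

module Defs where

open import Level using (Level; 0ℓ)
open import Algebra.Bundles using (CommutativeRing; RawRing)
import Algebra.Definitions.RawMonoid as RawMonoidOps
import Algebra.Definitions.RawSemiring as RawSemiringOps
open import Data.Bool.Base using (if_then_else_)
open import Data.Fin.Base using (Fin; zero; suc; toℕ; _↑ˡ_; _↑ʳ_; punchIn)
open import Data.Fin.Properties using () renaming (_≟_ to _≟ᶠ_)
open import Data.List.Base using (List; []; _∷_; map; length)
open import Data.Nat.Base as ℕ using (ℕ; zero; suc)
open import Data.Product.Base using (∃; _×_; _,_; proj₁; proj₂)
open import Data.Vec.Functional using (Vector; tail)
open import Relation.Binary.Core using (Rel)
open import Relation.Binary.Definitions using (Decidable)
open import Relation.Binary.Structures using (IsDecTotalOrder)
open import Relation.Nullary.Decidable using (⌊_⌋; _×-dec_)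

open RawMonoidOps ℕ.+-0-rawMonoid public using () renaming (sum to sumℕ)

-- The real numbers, axiomatised as a Dedekind-complete ordered field, hence
-- determined up to isomorphism.  The theory is the classical one: the order and
-- the equality are decidable.
record CompleteOrderedField : Set₁ where
  field
    commutativeRing : CommutativeRing 0ℓ 0ℓ

  open CommutativeRing commutativeRing public

  infix 4 _≤_
  infix 9 _⁻¹
  field
    _≤_             : Rel Carrier 0ℓ
    isDecTotalOrder : IsDecTotalOrder _≈_ _≤_
    -- No condition is imposed on the value of 0# ⁻¹.
    _⁻¹             : Carrier → Carrier
    ⁻¹-cong         : ∀ {x y} → x ≈ y → x ⁻¹ ≈ y ⁻¹
    ⁻¹-inverseʳ     : ∀ {x} → x ≉ 0# → x * x ⁻¹ ≈ 1#
    0≉1             : 0# ≉ 1#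
    +-monoʳ-≤       : ∀ z {x y} → x ≤ y → z + x ≤ z + y
    *-nonNegative   : ∀ {x y} → 0# ≤ x → 0# ≤ y → 0# ≤ x * y

  open IsDecTotalOrder isDecTotalOrder public using (_≟_; _≤?_)

  IsUpperBound : (Carrier → Set) → Carrier → Set
  IsUpperBound P b = ∀ x → P x → x ≤ b

  field
    supremum : (P : Carrier → Set) → ∃ P → ∃ (IsUpperBound P) →
               ∃ λ s → IsUpperBound P s × (∀ b → IsUpperBound P b → s ≤ b)

Matrix : ∀ {a} → Set a → ℕ → ℕ → Set a
Matrix A m n = Fin m → Fin n → A

-- For block sizes n₁, …, n_t, the position among n₁ + ⋯ + n_t of the a-th index
-- of the i-th block.
blockIndex : ∀ {t} (n : Vector ℕ t) (i : Fin t) → Fin (n i) → Fin (sumℕ n)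
blockIndex n zero    a = a ↑ˡ sumℕ (tail n)
blockIndex n (suc i) a = n zero ↑ʳ blockIndex (tail n) i a

block : ∀ {a} {A : Set a} {t} (n : Vector ℕ t) → Matrix A (sumℕ n) (sumℕ n) →
        (i j : Fin t) → Matrix A (n i) (n j)
block n M i j a b = M (blockIndex n i a) (blockIndex n j b)

module MatrixOps {c ℓ : Level} (R : RawRing c ℓ) where
  open RawRing R
  open RawSemiringOps rawSemiring using (sum; _^_)

  infix  4 _≈ᴹ_
  infixl 6 _+ᴹ_
  infixl 7 _•_

  _≈ᴹ_ : ∀ {m n} → Rel (Matrix Carrier m n) ℓ
  A ≈ᴹ B = ∀ i j → A i j ≈ B i j

  _+ᴹ_ : ∀ {m n} → Matrix Carrier m n → Matrix Carrier m n → Matrix Carrier m n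
  (A +ᴹ B) i j = A i j + B i j

  _•_ : ∀ {m n} → Carrier → Matrix Carrier m n → Matrix Carrier m n
  (x • A) i j = x * A i j

  I : ∀ {n} → Matrix Carrier n n
  I i j = if ⌊ i ≟ᶠ j ⌋ then 1# else 0#

  J : ∀ {m n} → Matrix Carrier m n
  J i j = 1#

  minor : ∀ {n} → Matrix Carrier (suc n) (suc n) → Fin (suc n) → Fin (suc n) →
          Matrix Carrier n n
  minor A i j a b = A (punchIn i a) (punchIn j b)

  -- Laplace expansion along the first row.
  det : ∀ {n} → Matrix Carrier n n → Carrier
  det {zero}  A = 1#
  det {suc n} A = sum λ j → (- 1#) ^ toℕ j * A zero j * det (minor A zero j)

-- A polynomial is its list of coefficients, constant term first; trailing zeros
-- are allowed.
module Polynomials {c ℓ : Level} (R : RawRing c ℓ) where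
  open RawRing R

  Poly : Set c
  Poly = List Carrier

  coeff : Poly → ℕ → Carrier
  coeff []      k       = 0#
  coeff (a ∷ p) zero    = a
  coeff (a ∷ p) (suc k) = coeff p k

  infixl 6 _+ᴾ_
  infixl 7 _*ᴾ_

  _+ᴾ_ : Poly → Poly → Poly
  []      +ᴾ q       = q
  (a ∷ p) +ᴾ []      = a ∷ p
  (a ∷ p) +ᴾ (b ∷ q) = (a + b) ∷ (p +ᴾ q)

  _*ᴾ_ : Poly → Poly → Poly
  []      *ᴾ q = []
  (a ∷ p) *ᴾ q = map (a *_) q +ᴾ (0# ∷ (p *ᴾ q))

  polyRawRing : RawRing c ℓ
  polyRawRing = record
    { Carrier = Poly
    ; _≈_     = λ p q → ∀ k → coeff p k ≈ coeff q k
    ; _+_     = _+ᴾ_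
    ; _*_     = _*ᴾ_
    ; -_      = map -_
    ; 0#      = []
    ; 1#      = 1# ∷ []
    }

  C : Carrier → Poly
  C a = a ∷ []

  X : Poly
  X = 0# ∷ 1# ∷ []

  charPoly : ∀ {n} → Matrix Carrier n n → Poly
  charPoly A = det (X • I +ᴹ λ i j → RawRing.-_ polyRawRing (C (A i j)))
    where open MatrixOps polyRawRing

  -- Synthetic division: if (q , r) is the result for z and p, then
  -- p = (X - z) q + r.  In particular r is the value of p at z.
  divideByLinear : Carrier → Poly → Poly × Carrier
  divideByLinear z []      = [] , 0#
  divideByLinear z (a ∷ p) with divideByLinear z p
  ... | q , r = (r ∷ q) , (a + z * r)

  module Roots (_≟_ : Decidable _≈_) where

    -- The number of successive times, up to the given bound, that X - z divides p.
    timesDivisible : ℕ → Carrier → Poly → ℕ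
    timesDivisible zero    z p = 0
    timesDivisible (suc k) z p with divideByLinear z p
    ... | q , r = if ⌊ r ≟ 0# ⌋ then suc (timesDivisible k z q) else 0

    -- The multiplicity of z as a root of p, for p nonzero: the degree of p is
    -- less than its length, so the bound is never reached.
    rootMultiplicity : Carrier → Poly → ℕ
    rootMultiplicity z p = timesDivisible (length p) z p

module Spectra (𝓡 : CompleteOrderedField) where
  open CompleteOrderedField 𝓡

  ℝ : Set
  ℝ = Carrier

  private
    ℝ-rawRing : RawRing 0ℓ 0ℓ
    ℝ-rawRing = CommutativeRing.rawRing commutativeRing

  open RawSemiringOps (RawRing.rawSemiring ℝ-rawRing) using (sum)
    renaming (_×_ to _×ℝ_)
  open MatrixOps ℝ-rawRing public using (_≈ᴹ_; _+ᴹ_; _•_; I; J)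

  record ℂ : Set where
    constructor _+i_
    field
      re im : ℝ
  open ℂ public

  infix 4 _≈ℂ_ _≟ℂ_

  _≈ℂ_ : Rel ℂ 0ℓ
  z ≈ℂ w = re z ≈ re w × im z ≈ im w

  _≟ℂ_ : Decidable _≈ℂ_
  z ≟ℂ w = (re z ≟ re w) ×-dec (im z ≟ im w)

  ℂ-rawRing : RawRing 0ℓ 0ℓ
  ℂ-rawRing = record
    { Carrier = ℂ
    ; _≈_     = _≈ℂ_
    ; _+_     = λ z w → (re z + re w) +i (im z + im w)
    ; _*_     = λ z w → (re z * re w - im z * im w) +i (re z * im w + im z * re w)
    ; -_      = λ z → (- re z) +i (- im z)
    ; 0#      = 0# +i 0#
    ; 1#      = 1# +i 0#
    }

  fromℝ : ℝ → ℂ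
  fromℝ x = x +i 0#

  -- A multiset of complex numbers is its multiplicity function, so the union of
  -- multisets adds multiplicities.
  Multiset : Set
  Multiset = ℂ → ℕ

  infixr 6 _∪_
  infix  9 _[_]

  _∪_ : Multiset → Multiset → Multiset
  (S ∪ T) z = S z ℕ.+ T z

  ⋃ : ∀ {t} → (Fin t → Multiset) → Multiset
  ⋃ S z = sumℕ λ i → S i z

  _[_] : ℂ → ℕ → Multiset
  (w [ m ]) z = if ⌊ w ≟ℂ z ⌋ then m else 0

  open Polynomials ℂ-rawRing using (charPoly; module Roots)
  open Roots _≟ℂ_ using (rootMultiplicity)

  -- Eigenvalues are counted with algebraic multiplicity.
  σ : ∀ {n} → Matrix ℝ n n → Multiset
  σ M z = rootMultiplicity z (charPoly λ i j → fromℝ (M i j))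

  -- The field has characteristic 0, so the inverse is a genuine one as soon as
  -- the block has a row.
  averageRowSum : ∀ {m n} → Matrix ℝ m n → ℝ
  averageRowSum {m} A = (sum λ a → sum λ b → A a b) * (m ×ℝ 1#) ⁻¹

  quotientMatrix : ∀ {t} (n : Fin t → ℕ) → Matrix ℝ (sumℕ n) (sumℕ n) → Matrix ℝ t t
  quotientMatrix n M i j = averageRowSum (block n M i j)

module Submission where

-- If two indices x and x′ lie in the same block i, then the rows x and x′ of
-- X I - M differ by d (e_x - e_x′) with d = X - p_i.  Expanding the determinant
-- after subtracting one row from the other gives d times the determinant of the
-- matrix in which the row x is deleted and the columns x and x′ are added.
-- Repeating this until each block has one index, the factor (X - p_i)^(n_i - 1)
-- comes out for each block and the columns of X I - B are left, so that
--   det (X I - M) = (∏ᵢ (X - p_i)^(n_i - 1)) det (X I - B)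
-- as polynomials, and multiplicities of roots add up under multiplication.

open import Defs
open import Algebra.Bundles using (CommutativeRing; RawRing)
import Algebra.Definitions.RawSemiring as RawSemiringOps
import Algebra.Properties.CommutativeMonoid.Sum
import Algebra.Properties.Monoid.Mult
import Algebra.Properties.Monoid.Sum
import Algebra.Properties.Ring
import Algebra.Properties.Semiring.Mult
import Algebra.Properties.Semiring.Sum
import Algebra.Solver.Ring
import Algebra.Solver.Ring.AlmostCommutativeRing as ACR
import Algebra.Solver.Ring.NaturalCoefficients.Default
open import Data.Bool.Base using (Bool; if_then_else_; true; false)
open import Data.Fin.Base using (Fin; zero; suc; toℕ; punchIn; splitAt)
open import Data.Fin.Properties
  using (join-splitAt; splitAt-↑ˡ; splitAt-↑ʳ; ↑ˡ-injective; ↑ʳ-injective)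
  renaming (_≟_ to _≟ᶠ_)
open import Data.List.Base using ([]; _∷_; map; length)
import Data.Maybe.Base as Maybe
open import Data.Nat.Base as ℕ using (ℕ; zero; suc; _∸_; z≤n; s≤s)
import Data.Nat.Properties as ℕ
open import Data.Product.Base using (∃; _×_; _,_; proj₁; proj₂)
open import Data.Sum.Base using (inj₁; inj₂)
open import Data.Vec.Base using (Vec; []; _∷_; lookup; replicate; tabulate; _++_)
open import Data.Vec.Properties
  using (lookup-++ˡ; lookup-++ʳ; lookup-replicate; lookup∘tabulate)
open import Function.Base using (_∘_; flip)
open import Level using (0ℓ; _⊔_)
open import Relation.Binary.Bundles using (Setoid)
open import Relation.Binary.Consequences using (dec⇒weaklyDec)
open import Relation.Binary.Construct.Closure.ReflexiveTransitive
  using (Star; ε; _◅_; _◅◅_; gmap)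
open import Relation.Binary.Definitions using (Decidable)
open import Relation.Binary.PropositionalEquality as ≡ using (_≡_; _≢_; _≗_)
open import Relation.Binary.Structures using (IsDecTotalOrder)
open import Relation.Nullary.Decidable using (⌊_⌋; yes; no)
open import Relation.Nullary.Negation using (¬_; contradiction)

-- The induction needs a family of matrices that the basic step does not leave. Give every column y
-- a weight w_y and let the entries be w_y S(i, j) + d_i [x = y], where i and j are the blocks of x
-- and y. Deleting a row and adding two columns of the same block keeps this form and merely adds
-- the two weights. Weights 1 give X I - M, weights n_j give X I - B; they sit on the columns
-- because B is made of row sums. Nothing is divided, so the argument runs over any commutative ring
-- and applies directly to polynomials.
--
-- The other obstacle is that a spectrum is computed, by repeated synthetic division of coefficient
-- lists that may end in zeros. The computation is replaced by a relation `Multiplicity`, a chain of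
-- factorisations by X - z. It respects equality of polynomials, and it is additive under products
-- because ℂ has no zero divisors. The computed number satisfies it once the polynomial is nonzero,
-- as every characteristic polynomial is: its coefficient of X^n is det I = 1.

-- A pair (a , b) of natural numbers is the integer coefficient a - b.
module IntegerSolver {c ℓ} (R : CommutativeRing c ℓ) where
  open CommutativeRing R
  open Algebra.Properties.Semiring.Mult semiring using (×-homo-+; ×1-homo-*)
    renaming (_×_ to _·_)
  open Algebra.Properties.Ring ring
  open import Relation.Binary.Reasoning.Setoid setoid
  private
    module N = Algebra.Solver.Ring.NaturalCoefficients.Default commutativeSemiring

    coefficients : RawRing 0ℓ 0ℓ
    coefficients = record
      { Carrier = ℕ × ℕ
      ; _≈_ = λ { (a , b) (c , d) → a ℕ.+ d ≡ c ℕ.+ b }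
      ; _+_ = λ { (a , b) (c , d) → a ℕ.+ c , b ℕ.+ d }
      ; _*_ = λ { (a , b) (c , d) → a ℕ.* c ℕ.+ b ℕ.* d , a ℕ.* d ℕ.+ b ℕ.* c }
      ; -_  = λ { (a , b) → b , a }
      ; 0#  = 0 , 0
      ; 1#  = 1 , 0
      }

    ⟦_⟧ : ℕ × ℕ → Carrier
    ⟦ a , b ⟧ = a · 1# + - (b · 1#)

    -- With `- 1#` as an extra variable e, identities with subtraction become semiring identities
    -- that `N.solve` can check. For products the relation e * e ≈ 1# is inserted beforehand.
    neg : ∀ x → - x ≈ - 1# * x
    neg x = sym (-1*x≈-x x)

    -1*-1≈1 : - 1# * - 1# ≈ 1#
    -1*-1≈1 = trans (-1*x≈-x (- 1#)) (-‿involutive 1#)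

    ⟦⟧-homo-+ : ∀ x y u v → (x + u) + - (y + v) ≈ (x + - y) + (u + - v)
    ⟦⟧-homo-+ x y u v = begin
      (x + u) + - (y + v)                   ≈⟨ +-congˡ (neg _) ⟩
      (x + u) + - 1# * (y + v)
        ≈⟨ N.solve 5
            (λ x y u v e → (x N.:+ u) N.:+ e N.:* (y N.:+ v) N.:= (x N.:+ e N.:* y) N.:+
            (u N.:+ e N.:* v)) refl x y u v (- 1#) ⟩
      (x + - 1# * y) + (u + - 1# * v)       ≈⟨ +-cong (+-congˡ (neg y)) (+-congˡ (neg v)) ⟨
      (x + - y) + (u + - v)                 ∎

    ⟦⟧-homo-* : ∀ x y u v →
                (x * u + y * v) + - (x * v + y * u) ≈ (x + - y) * (u + - v)
    ⟦⟧-homo-* x y u v = begin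
      (x * u + y * v) + - (x * v + y * u)
        ≈⟨ +-cong (+-congˡ (trans (sym (*-identityˡ _)) (*-congʳ (sym -1*-1≈1)))) (neg _) ⟩
      (x * u + (- 1# * - 1#) * (y * v)) + - 1# * (x * v + y * u)
        ≈⟨ N.solve 5
            (λ x y u v e → (x N.:* u N.:+ (e N.:* e) N.:* (y N.:* v)) N.:+ e N.:*
            (x N.:* v N.:+ y N.:* u) N.:= (x N.:+ e N.:* y) N.:* (u N.:+ e N.:* v)) refl x y u v
            (- 1#) ⟩
      (x + - 1# * y) * (u + - 1# * v)                ≈⟨ *-cong (+-congˡ (neg y)) (+-congˡ (neg v)) ⟨
      (x + - y) * (u + - v)                          ∎

    ring′ : ACR.AlmostCommutativeRing c ℓ
    ring′ = ACR.fromCommutativeRing R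

    homo : coefficients ACR.-Raw-AlmostCommutative⟶ ring′
    homo = record
      { ⟦_⟧ = ⟦_⟧
      ; +-homo = λ { (a , b) (c , d) → trans
          (+-cong (×-homo-+ 1# a c) (-‿cong (×-homo-+ 1# b d)))
          (⟦⟧-homo-+ (a · 1#) (b · 1#) (c · 1#) (d · 1#)) }
      ; *-homo = λ { (a , b) (c , d) → trans
          (+-cong (·-homo a c b d) (-‿cong (·-homo a d b c)))
          (⟦⟧-homo-* (a · 1#) (b · 1#) (c · 1#) (d · 1#)) }
      ; -‿homo = λ { (a , b) → sym (⁻¹-anti-homo‿- _ _) }
      ; 0-homo = -‿inverseʳ 0#
      ; 1-homo = trans (+-cong (+-identityʳ 1#) -0#≈0#) (+-identityʳ 1#)
      }
      where
      ·-homo : ∀ a c b d → (a ℕ.* c ℕ.+ b ℕ.* d) · 1# ≈ (a · 1#) * (c · 1#) + (b · 1#) * (d · 1#)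
      ·-homo a c b d = trans (×-homo-+ 1# (a ℕ.* c) (b ℕ.* d))
          (+-cong (×1-homo-* a c) (×1-homo-* b d))

    _≟_ : ∀ x y → Maybe.Maybe (⟦ x ⟧ ≈ ⟦ y ⟧)
    (a , b) ≟ (c , d) = Maybe.map equal (dec⇒weaklyDec ℕ._≟_ (a ℕ.+ d) (c ℕ.+ b))
      where
      cross : ∀ x y z → x + - y ≈ (x + z) + - (y + z)
      cross x y z = begin
        x + - y                    ≈⟨ +-identityʳ _ ⟨
        (x + - y) + 0#             ≈⟨ +-congˡ (-‿inverseʳ z) ⟨
        (x + - y) + (z + - z)      ≈⟨ ⟦⟧-homo-+ x y z z ⟨
        (x + z) + - (y + z)        ∎
      equal : a ℕ.+ d ≡ c ℕ.+ b → ⟦ a , b ⟧ ≈ ⟦ c , d ⟧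
      equal eq = begin
        a · 1# + - (b · 1#)                           ≈⟨ cross _ _ _ ⟩
        (a · 1# + d · 1#) + - (b · 1# + d · 1#)
          ≈⟨ +-cong (trans (sym (×-homo-+ 1# a d))
              (trans (reflexive (≡.cong (_· 1#) eq)) (×-homo-+ 1# c b))) (-‿cong (+-comm _ _)) ⟩
        (c · 1# + b · 1#) + - (d · 1# + b · 1#)       ≈⟨ cross _ _ _ ⟨
        c · 1# + - (d · 1#)                           ∎

  open Algebra.Solver.Ring coefficients ring′ homo _≟_ public
    using (solve; _:=_; _:+_; _:*_; :-_; _:-_)

-- Determinants over a commutative ring: expansions, swaps, equal and twin rows.

-- The swap of the positions k and k + 1, recursive in k so that deleting column zero turns
-- `transpose (suc k)` into `transpose k` definitionally.
transpose : ∀ {n} → Fin n → Fin (suc n) → Fin (suc n)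
transpose {suc n} zero    zero          = suc zero
transpose {suc n} zero    (suc zero)    = zero
transpose {suc n} zero    (suc (suc x)) = suc (suc x)
transpose         (suc k) zero          = zero
transpose         (suc k) (suc x)       = suc (transpose k x)

⌊suc≟suc⌋ : ∀ {n} (i j : Fin n) → ⌊ suc i ≟ᶠ suc j ⌋ ≡ ⌊ i ≟ᶠ j ⌋
⌊suc≟suc⌋ i j with i ≟ᶠ j
... | yes _ = ≡.refl
... | no  _ = ≡.refl

module Determinants {c ℓ} (R : CommutativeRing c ℓ) where
  open CommutativeRing R hiding (zero)
  open MatrixOps rawRing
  open RawSemiringOps (RawRing.rawSemiring rawRing) using (sum; _^_)
  open Algebra.Properties.Monoid.Sum +-monoid using (sum-cong-≋; sum-replicate-zero)
  open Algebra.Properties.CommutativeMonoid.Sum +-commutativeMonoid using (∑-distrib-+; ∑-comm)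
  open Algebra.Properties.Semiring.Sum semiring using (*-distribˡ-sum)
  open Algebra.Properties.Ring ring using (-1*x≈-x; -‿involutive)
  open IntegerSolver R
  open import Relation.Binary.Reasoning.Setoid setoid

  sum-zero : ∀ {n} (f : Fin n → Carrier) → (∀ i → f i ≈ 0#) → sum f ≈ 0#
  sum-zero {n} f f≈0 = trans (sum-cong-≋ f≈0) (sum-replicate-zero n)

  sign : ∀ {n} → Fin n → Carrier
  sign i = (- 1#) ^ toℕ i

  det-cong : ∀ {n} {A B : Matrix Carrier n n} → A ≈ᴹ B → det A ≈ det B
  det-cong {zero}  A≈B = refl
  det-cong {suc n} A≈B = sum-cong-≋ λ j →
    *-cong (*-congˡ {sign j} (A≈B zero j)) (det-cong λ a b → A≈B (suc a) (punchIn j b))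

  columnExpansion : ∀ {n} → Matrix Carrier (suc n) (suc n) → Carrier
  columnExpansion A = sum λ i → sign i * A i zero * det (minor A i zero)

  -- The two expansions share their corner term. In the remaining terms each minor is expanded once
  -- more, and both double sums run over the same twice-reduced minors `D`; exchanging the sums
  -- moves the extra sign from the column index to the row index.
  det≈columnExpansion : ∀ {n} (A : Matrix Carrier (suc n) (suc n)) →
                        det A ≈ columnExpansion A
  det≈columnExpansion {zero}  A = refl
  det≈columnExpansion {suc n} A = +-congˡ (begin
    sum (λ j → sign (suc j) * A zero (suc j) * det (minor A zero (suc j)))
      ≈⟨ sum-cong-≋
          (λ j → trans (*-congˡ {p j} (det≈columnExpansion (minor A zero (suc j))))
          (*-distribˡ-sum (p j) (λ i → sign i * A (suc i) zero * D i j))) ⟩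
    sum (λ j → sum λ i → p j * (sign i * A (suc i) zero * D i j))
      ≈⟨ ∑-comm (λ j i → p j * (sign i * A (suc i) zero * D i j)) ⟩
    sum (λ i → sum λ j → p j * (sign i * A (suc i) zero * D i j))
      ≈⟨ sum-cong-≋
          (λ i → sum-cong-≋ λ j → rearrange (- 1#) (sign j) (A zero (suc j)) (sign i)
          (A (suc i) zero) (D i j)) ⟩
    sum (λ i → sum λ j → q i * (sign j * A zero (suc j) * D i j))
      ≈⟨ sum-cong-≋ (λ i → *-distribˡ-sum (q i) (λ j → sign j * A zero (suc j) * D i j)) ⟨
    sum (λ i → q i * det (minor A (suc i) zero))
      ∎)
    where
    D : Matrix Carrier (suc n) (suc n)
    D i j = det (minor (minor A zero (suc j)) i zero)
    p q : Fin (suc n) → Carrier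
    p j = sign (suc j) * A zero (suc j)
    q i = sign (suc i) * A (suc i) zero
    rearrange : ∀ e s a u b d → e * s * a * (u * b * d) ≈ e * u * b * (s * a * d)
    rearrange = solve 6
        (λ e s a u b d → e :* s :* a :* (u :* b :* d) := e :* u :* b :* (s :* a :* d)) refl

  -- The first row of `flip A` is the first column of `A`, and by induction its minors may be
  -- transposed back.
  det-flip : ∀ {n} (A : Matrix Carrier n n) → det (flip A) ≈ det A
  det-flip {zero}  A = refl
  det-flip {suc n} A = begin
    det (flip A)
      ≈⟨ sum-cong-≋ (λ j → *-congˡ {sign j * A j zero} (det-flip (minor A j zero))) ⟩
    columnExpansion A ≈⟨ det≈columnExpansion A ⟨
    det A             ∎

  sum-neg : ∀ {n} {f g : Fin n → Carrier} → (∀ i → f i ≈ - g i) → sum f ≈ - sum g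
  sum-neg {f = f} {g} f≈-g = begin
    sum f                     ≈⟨ sum-cong-≋ (λ i → trans (f≈-g i) (sym (-1*x≈-x (g i)))) ⟩
    sum (λ i → - 1# * g i)    ≈⟨ *-distribˡ-sum (- 1#) g ⟨
    - 1# * sum g              ≈⟨ -1*x≈-x (sum g) ⟩
    - sum g                   ∎

  private
    *-neg : ∀ x {y z} → y ≈ - z → x * y ≈ - (x * z)
    *-neg x {y} {z} y≈-z = trans (*-congˡ y≈-z)
        (solve 2 (λ x z → x :* :- z := :- (x :* z)) refl x z)

    minor-transpose : ∀ {n} (j : Fin (suc n)) (b : Fin (suc (suc n))) →
      transpose zero (punchIn (suc (suc j)) b) ≡ punchIn (suc (suc j)) (transpose zero b)
    minor-transpose j zero          = ≡.refl
    minor-transpose j (suc zero)    = ≡.refl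
    minor-transpose j (suc (suc b)) = ≡.refl

    transpose-punchIn₀ : ∀ {n} (b : Fin (suc n)) → transpose zero (suc b) ≡ punchIn (suc zero) b
    transpose-punchIn₀ zero    = ≡.refl
    transpose-punchIn₀ (suc b) = ≡.refl

    transpose-punchIn₁ : ∀ {n} (b : Fin (suc n)) → transpose zero (punchIn (suc zero) b) ≡ suc b
    transpose-punchIn₁ zero    = ≡.refl
    transpose-punchIn₁ (suc b) = ≡.refl

  -- For `suc k` the swap misses column zero and passes to the minors of the column expansion. For
  -- `zero` the row expansion is used: its first two terms change places, which costs a sign, and in
  -- all later terms both swapped columns survive in the minor.
  det-transposeColumns : ∀ {n} (k : Fin n) (A : Matrix Carrier (suc n) (suc n)) →
                         det (λ i j → A i (transpose k j)) ≈ - det A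
  det-transposeColumns (suc k) A = begin
    det A′                  ≈⟨ det≈columnExpansion A′ ⟩
    columnExpansion A′
      ≈⟨ sum-neg (λ i → *-neg (sign i * A i zero) (det-transposeColumns k (minor A i zero))) ⟩
    - columnExpansion A     ≈⟨ -‿cong (det≈columnExpansion A) ⟨
    - det A                 ∎
    where A′ = λ i j → A i (transpose (suc k) j)
  det-transposeColumns {suc n} zero A = begin
    1# * a 1F * det (minor A′ zero zero) + (- 1# * 1# * a zero * det (minor A′ zero 1F) + sum f)
      ≈⟨ +-cong (*-congˡ (det-cong λ i b → reflexive (≡.cong (A (suc i)) (transpose-punchIn₀ b))))
                (+-cong (*-congˡ
                    (det-cong λ i b → reflexive (≡.cong (A (suc i)) (transpose-punchIn₁ b))))
                    (sum-neg (later n A))) ⟩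
    1# * a 1F * D 1F +
        (- 1# * 1# * a zero * D zero + - sum
        (λ j → sign (suc (suc j)) * a (suc (suc j)) * D (suc (suc j))))
      ≈⟨ solve 6 (λ o x y u v s → o :* x :* u :+ (:- o :* o :* y :* v :+ :- s)
          := :- (o :* y :* (o :* v) :+ (:- o :* x :* u :+ s))) refl 1# (a 1F) (a zero) (D 1F)
          (D zero) _ ⟩
    - (1# * a zero * (1# * D zero) + (- 1# * a 1F * D 1F + _))
      ≈⟨ -‿cong (+-cong (*-congˡ (*-identityˡ _))
          (+-congʳ (*-congʳ (*-congʳ (sym (*-identityʳ _)))))) ⟩
    - det A ∎
    where
    1F : ∀ {n} → Fin (suc (suc n))
    1F = suc zero
    a = A zero
    A′ : Matrix Carrier (suc (suc n)) (suc (suc n))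
    A′ i j = A i (transpose zero j)
    D : Fin (suc (suc n)) → Carrier
    D j = det (minor A zero j)
    f : Fin n → Carrier
    f j = sign (suc (suc j)) * a (suc (suc j)) * det (minor A′ zero (suc (suc j)))
    -- The size is generalised anew: an index `j : Fin n` forces n to be a successor, and only then
    -- are two columns left in the minor to swap.
    later : ∀ n (A : Matrix Carrier (suc (suc n)) (suc (suc n))) (j : Fin n) →
      sign (suc (suc j)) * A zero (suc (suc j)) *
      det (minor (λ i j → A i (transpose zero j)) zero (suc (suc j))) ≈
      - (sign (suc (suc j)) * A zero (suc (suc j)) * det (minor A zero (suc (suc j))))
    later (suc n) A j = *-neg _ (trans
      (det-cong λ i b → reflexive (≡.cong (A (suc i)) (minor-transpose j b)))
      (det-transposeColumns zero (minor A zero (suc (suc j)))))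

  det-transposeRows : ∀ {n} (k : Fin n) (A : Matrix Carrier (suc n) (suc n)) →
                      det (λ i j → A (transpose k i) j) ≈ - det A
  det-transposeRows k A = begin
    det (λ i j → A (transpose k i) j)  ≈⟨ det-flip (λ i j → A (transpose k i) j) ⟨
    det (λ j i → A (transpose k i) j)  ≈⟨ det-transposeColumns k (flip A) ⟩
    - det (flip A)                     ≈⟨ -‿cong (det-flip A) ⟩
    - det A                            ∎

  det-conjugate : ∀ {n} (k : Fin n) (A : Matrix Carrier (suc n) (suc n)) →
                  det (λ i j → A (transpose k i) (transpose k j)) ≈ det A
  det-conjugate k A = begin
    det (λ i j → A (transpose k i) (transpose k j))
      ≈⟨ det-transposeColumns k (λ i j → A (transpose k i) j) ⟩
    - det (λ i j → A (transpose k i) j)              ≈⟨ -‿cong (det-transposeRows k A) ⟩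
    - - det A                                        ≈⟨ -‿involutive _ ⟩
    det A                                            ∎

  -- Antisymmetry would only give det A = - det A, too little where 2 can be a zero divisor. In the
  -- column expansion the first two terms cancel, since each of their minors keeps one copy of the
  -- repeated row, and every later minor still contains both copies.
  det-equalRows : ∀ {n} (A : Matrix Carrier (suc (suc n)) (suc (suc n))) →
                  (∀ j → A zero j ≈ A (suc zero) j) → det A ≈ 0#
  det-equalRows {n} A eq = begin
    det A              ≈⟨ det≈columnExpansion A ⟩
    1# * a * D + (- 1# * 1# * A 1F zero * det (minor A 1F zero) + sum f)
      ≈⟨ +-congˡ (+-cong (*-cong (*-congˡ (sym (eq zero))) (det-cong minors))
          (sum-zero f (later n A eq))) ⟩
    1# * a * D + (- 1# * 1# * a * D + 0#)
      ≈⟨ +-congˡ (trans (+-identityʳ _) (*-congʳ (*-congʳ (*-identityʳ _)))) ⟩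
    1# * a * D + (- 1# * a * D)
      ≈⟨ solve 3 (λ o a d → o :* a :* d :+ (:- o :* a :* d) := (o :- o) :* a :* d) refl 1# a D ⟩
    (1# - 1#) * a * D  ≈⟨ *-congʳ (trans (*-congʳ (-‿inverseʳ 1#)) (zeroˡ a)) ⟩
    0# * D             ≈⟨ zeroˡ D ⟩
    0#                 ∎
    where
    1F : ∀ {n} → Fin (suc (suc n))
    1F = suc zero
    a = A zero zero
    D = det (minor A zero zero)
    f : Fin n → Carrier
    f i = sign (suc (suc i)) * A (suc (suc i)) zero * det (minor A (suc (suc i)) zero)
    minors : minor A 1F zero ≈ᴹ minor A zero zero
    minors zero    j = eq (suc j)
    minors (suc i) j = refl
    later : ∀ n (A : Matrix Carrier (suc (suc n)) (suc (suc n))) →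
      (∀ j → A zero j ≈ A (suc zero) j) → (i : Fin n) →
      sign (suc (suc i)) * A (suc (suc i)) zero * det (minor A (suc (suc i)) zero) ≈ 0#
    later (suc n) A eq i =
      trans (*-congˡ (det-equalRows (minor A (suc (suc i)) zero) λ j → eq (suc j))) (zeroʳ _)

  -- The minors along column zero do not contain that column, so the three matrices share them.
  det-additiveColumn : ∀ {n} (A B C : Matrix Carrier (suc n) (suc n)) →
    (∀ i → C i zero ≈ A i zero + B i zero) →
    (∀ i j → C i (suc j) ≈ A i (suc j)) → (∀ i j → C i (suc j) ≈ B i (suc j)) →
    det C ≈ det A + det B
  det-additiveColumn A B C C₀ CA CB = begin
    det C              ≈⟨ det≈columnExpansion C ⟩
    columnExpansion C  ≈⟨ sum-cong-≋ (λ i → trans (*-congʳ (*-congˡ (C₀ i))) (trans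
                            (solve 4 (λ s a b d → s :* (a :+ b) :* d := s :* a :* d :+ s :* b :* d)
                                refl (sign i) _ _ _)
                            (+-cong (*-congˡ (det-cong λ a b → CA (punchIn i a) b))
                                (*-congˡ (det-cong λ a b → CB (punchIn i a) b))))) ⟩
    sum (λ i → sign i * A i zero * det (minor A i zero) + sign i * B i zero * det (minor B i zero))
                       ≈⟨ ∑-distrib-+ (λ i → sign i * A i zero * det (minor A i zero))
                           (λ i → sign i * B i zero * det (minor B i zero)) ⟩
    columnExpansion A + columnExpansion B
                       ≈⟨ +-cong (det≈columnExpansion A) (det≈columnExpansion B) ⟨
    det A + det B      ∎

  -- Subtracting row 1 from row 0 leaves d (e₀ - e₁) in row 0.  The minors
  -- along these two entries differ in a single column.
  det-twin : ∀ {n} (A : Matrix Carrier (suc (suc n)) (suc (suc n)))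
    (N : Matrix Carrier (suc n) (suc n)) (d : Carrier) →
    A zero zero ≈ A (suc zero) zero + d →
    A (suc zero) (suc zero) ≈ A zero (suc zero) + d →
    (∀ j → A zero (suc (suc j)) ≈ A (suc zero) (suc (suc j))) →
    (∀ i → N i zero ≈ A (suc i) zero + A (suc i) (suc zero)) →
    (∀ i j → N i (suc j) ≈ A (suc i) (suc (suc j))) →
    det A ≈ d * det N
  det-twin {n} A N d A₀₀ A₁₁ A₀ⱼ N₀ Nⱼ = begin
    1# * a zero * D zero +
        (- 1# * 1# * a 1F * D 1F + sum (λ j → s j * a (suc (suc j)) * D (suc (suc j))))
      ≈⟨ +-cong (*-congʳ (*-congˡ A₀₀))
          (+-cong (*-congʳ (*-cong (*-identityʳ _) a₁))
          (sum-cong-≋ λ j → *-congʳ (*-congˡ (A₀ⱼ j)))) ⟩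
    1# * (b zero + d) * D zero + (- 1# * (b 1F - d) * D 1F + S)
      ≈⟨ solve 7 (λ o x y d u v s → o :* (x :+ d) :* u :+ (:- o :* (y :- d) :* v :+ s)
          := (o :* x :* u :+ (:- o :* y :* v :+ s)) :+ o :* (d :* (v :+ u))) refl 1# (b zero)
          (b 1F) d (D zero) (D 1F) S ⟩
    (1# * b zero * D zero + (- 1# * b 1F * D 1F + S)) + 1# * (d * (D 1F + D zero))
      ≈⟨ +-cong (+-congˡ (+-congʳ (*-congʳ (*-congʳ (sym (*-identityʳ _)))))) (*-identityˡ _) ⟩
    -- The minors along row 0 do not see row 0, so the terms free of `d` are the expansion of `A′`,
    -- which has row 1 twice.
    det A′ + d * (D 1F + D zero)
      ≈⟨ +-congʳ (det-equalRows A′ λ j → refl) ⟩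
    0# + d * (D 1F + D zero)
      ≈⟨ +-identityˡ _ ⟩
    d * (D 1F + D zero)
      ≈⟨ *-congˡ (det-additiveColumn (minor A zero 1F) (minor A zero zero) N N₀ Nⱼ Nⱼ) ⟨
    d * det N ∎
    where
    1F : ∀ {n} → Fin (suc (suc n))
    1F = suc zero
    a = A zero
    b = A 1F
    s : Fin n → Carrier
    s j = sign (suc (suc j))
    D : Fin (suc (suc n)) → Carrier
    D j = det (minor A zero j)
    S = sum (λ j → s j * b (suc (suc j)) * D (suc (suc j)))
    A′ : Matrix Carrier (suc (suc n)) (suc (suc n))
    A′ zero    = A 1F
    A′ (suc i) = A (suc i)
    a₁ : a 1F ≈ b 1F - d
    a₁ = begin
      a 1F              ≈⟨ solve 2 (λ x d → x := (x :+ d) :- d) refl (a 1F) d ⟩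
      (a 1F + d) - d    ≈⟨ +-congʳ A₁₁ ⟨
      b 1F - d          ∎

  det-I : ∀ n → det (I {n}) ≈ 1#
  det-I zero    = refl
  det-I (suc n) = begin
    1# * 1# * det (minor (I {suc n}) zero zero) + _
      ≈⟨ +-cong (*-cong (*-identityˡ 1#) (det-cong minor-I))
          (sum-zero {n} _ λ j → trans (*-congʳ (zeroʳ _)) (zeroˡ _)) ⟩
    1# * det (I {n}) + 0#                   ≈⟨ trans (+-identityʳ _) (*-identityˡ _) ⟩
    det (I {n})                             ≈⟨ det-I n ⟩
    1#                                      ∎
    where
    minor-I : minor (I {suc n}) zero zero ≈ᴹ I {n}
    minor-I i j rewrite ⌊suc≟suc⌋ i j = refl

-- Merging the indices of a block.

⌊transpose≟transpose⌋ : ∀ {n} (k : Fin n) (i j : Fin (suc n)) →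
  ⌊ transpose k i ≟ᶠ transpose k j ⌋ ≡ ⌊ i ≟ᶠ j ⌋
⌊transpose≟transpose⌋ {suc n} zero zero          zero          = ≡.refl
⌊transpose≟transpose⌋ {suc n} zero zero          (suc zero)    = ≡.refl
⌊transpose≟transpose⌋ {suc n} zero zero          (suc (suc j)) = ≡.refl
⌊transpose≟transpose⌋ {suc n} zero (suc zero)    zero          = ≡.refl
⌊transpose≟transpose⌋ {suc n} zero (suc zero)    (suc zero)    = ≡.refl
⌊transpose≟transpose⌋ {suc n} zero (suc zero)    (suc (suc j)) = ≡.refl
⌊transpose≟transpose⌋ {suc n} zero (suc (suc i)) zero          = ≡.refl
⌊transpose≟transpose⌋ {suc n} zero (suc (suc i)) (suc zero)    = ≡.refl
⌊transpose≟transpose⌋ {suc n} zero (suc (suc i)) (suc (suc j)) = ≡.refl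
⌊transpose≟transpose⌋ (suc k) zero    zero    = ≡.refl
⌊transpose≟transpose⌋ (suc k) zero    (suc j) = ≡.refl
⌊transpose≟transpose⌋ (suc k) (suc i) zero    = ≡.refl
⌊transpose≟transpose⌋ (suc k) (suc i) (suc j) =
  ≡.trans (⌊suc≟suc⌋ (transpose k i) (transpose k j))
    (≡.trans (⌊transpose≟transpose⌋ k i j) (≡.sym (⌊suc≟suc⌋ i j)))

module WeightedMatrices {c ℓ} (R : CommutativeRing c ℓ) {L : Set}
  (S : L → L → CommutativeRing.Carrier R) (d : L → CommutativeRing.Carrier R) where
  open CommutativeRing R hiding (zero)
  open MatrixOps rawRing
  open RawSemiringOps (RawRing.rawSemiring rawRing) using (_^_; product) renaming (_×_ to _·_)
  open Algebra.Properties.Monoid.Mult +-monoid using (×-homo-+)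
  open Determinants R
  open import Relation.Binary.Reasoning.Setoid setoid

  -- An entry (i , w) stands for w indices of the block i whose columns have
  -- been added up, so that [ (i₁ , n₁) , … , (i_t , n_t) ] gives a quotient
  -- matrix, and entries of weight 1 the original one.
  weighted : ∀ {n} → Vec (L × ℕ) n → Matrix Carrier n n
  weighted v x y =
    proj₂ (lookup v y) · S (proj₁ (lookup v x)) (proj₁ (lookup v y)) +
    d (proj₁ (lookup v x)) * I x y

  -- Adjacent swaps, whose effect on `det` is known. Rows and columns move together, so the signs
  -- cancel.
  data _⇄_ : ∀ {n} → Vec (L × ℕ) n → Vec (L × ℕ) n → Set where
    here  : ∀ {n a b} {v : Vec (L × ℕ) n} → (a ∷ b ∷ v) ⇄ (b ∷ a ∷ v)
    there : ∀ {n a} {v w : Vec (L × ℕ) n} → v ⇄ w → (a ∷ v) ⇄ (a ∷ w)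

  _⇄*_ : ∀ {n} → Vec (L × ℕ) n → Vec (L × ℕ) n → Set
  _⇄*_ = Star _⇄_

  ⇄-transpose : ∀ {n} {v w : Vec (L × ℕ) (suc n)} → v ⇄ w →
                ∃ λ k → ∀ x → lookup v (transpose k x) ≡ lookup w x
  ⇄-transpose here = zero , λ { zero → ≡.refl ; (suc zero) → ≡.refl ; (suc (suc x)) → ≡.refl }
  ⇄-transpose {suc n} (there s) with ⇄-transpose s
  ... | k , eq = suc k , λ { zero → ≡.refl ; (suc x) → eq x }
  ⇄-transpose {zero} (there ())

  det-⇄ : ∀ {n} {v w : Vec (L × ℕ) n} → v ⇄ w → det (weighted v) ≈ det (weighted w)
  det-⇄ {zero} ()
  det-⇄ {suc n} {v} {w} s with ⇄-transpose s
  ... | k , eq = begin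
    det (weighted v)                                              ≈⟨ det-conjugate k (weighted v) ⟨
    det (λ x y → weighted v (transpose k x) (transpose k y))      ≈⟨ det-cong same ⟩
    det (weighted w)                                              ∎
    where
    same : (λ x y → weighted v (transpose k x) (transpose k y)) ≈ᴹ weighted w
    same x y rewrite eq x | eq y | ⌊transpose≟transpose⌋ k x y = refl

  det-⇄* : ∀ {n} {v w : Vec (L × ℕ) n} → v ⇄* w → det (weighted v) ≈ det (weighted w)
  det-⇄* ε        = refl
  det-⇄* (s ◅ ss) = trans (det-⇄ s) (det-⇄* ss)

  -- The S-part of a row depends only on the label of the row, because the weights sit on the
  -- columns. The first two rows therefore differ only by `d i` in their diagonal places, and adding
  -- the first two columns adds their weights.
  det-mergeHead : ∀ {n} i m k (v : Vec (L × ℕ) n) →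
    det (weighted ((i , m) ∷ (i , k) ∷ v)) ≈ d i * det (weighted ((i , m ℕ.+ k) ∷ v))
  det-mergeHead {n} i m k v =
    det-twin (weighted ((i , m) ∷ (i , k) ∷ v)) (weighted ((i , m ℕ.+ k) ∷ v)) (d i)
      (diagonal (m · S i i)) (diagonal (k · S i i)) (λ j → refl) column₀ columns
    where
    diagonal : ∀ s → s + d i * 1# ≈ (s + d i * 0#) + d i
    diagonal s = +-cong (sym (trans (+-congˡ (zeroʳ _)) (+-identityʳ s))) (*-identityʳ _)
    column₀ : ∀ x → weighted ((i , m ℕ.+ k) ∷ v) x zero ≈
      weighted ((i , m) ∷ (i , k) ∷ v) (suc x) zero +
      weighted ((i , m) ∷ (i , k) ∷ v) (suc x) (suc zero)
    column₀ zero = begin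
      (m ℕ.+ k) · S i i + d i * 1#                          ≈⟨ +-congʳ (×-homo-+ (S i i) m k) ⟩
      (m · S i i + k · S i i) + d i * 1#                    ≈⟨ +-assoc _ _ _ ⟩
      m · S i i + (k · S i i + d i * 1#)
        ≈⟨ +-congʳ (trans (+-congˡ (zeroʳ _)) (+-identityʳ _)) ⟨
      (m · S i i + d i * 0#) + (k · S i i + d i * 1#)       ∎
    column₀ (suc x) = begin
      (m ℕ.+ k) · S j i + d j * 0#
        ≈⟨ +-cong (×-homo-+ (S j i) m k) (zeroʳ _) ⟩
      (m · S j i + k · S j i) + 0#                          ≈⟨ +-identityʳ _ ⟩
      m · S j i + k · S j i
        ≈⟨ +-cong (trans (+-congˡ (zeroʳ _)) (+-identityʳ _))
            (trans (+-congˡ (zeroʳ _)) (+-identityʳ _)) ⟨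
      (m · S j i + d j * 0#) + (k · S j i + d j * 0#)       ∎
      where j = proj₁ (lookup v x)
    columns : ∀ x y → weighted ((i , m ℕ.+ k) ∷ v) x (suc y) ≈
      weighted ((i , m) ∷ (i , k) ∷ v) (suc x) (suc (suc y))
    columns zero    y = refl
    columns (suc x) y rewrite ⌊suc≟suc⌋ (suc x) (suc y) = refl

  data Merge (i : L) : ∀ {n} → Vec (L × ℕ) (suc n) → Vec (L × ℕ) n → Set where
    here  : ∀ {n m k} {v : Vec (L × ℕ) n} → Merge i ((i , m) ∷ (i , k) ∷ v) ((i , m ℕ.+ k) ∷ v)
    there : ∀ {n a} {v : Vec (L × ℕ) (suc n)} {w} → Merge i v w → Merge i (a ∷ v) (a ∷ w)

  -- Moving past one entry takes two swaps for the pair and one for its merged form. A merge forces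
  -- n to be a successor, which its index does not show; `eq` records this.
  merge-toHead : ∀ {n i} {v : Vec (L × ℕ) (suc n)} {w} → Merge i v w →
    ∃ λ m → ∃ λ k → ∃ λ n′ → ∃ λ (eq : n ≡ suc n′) → ∃ λ (u : Vec (L × ℕ) n′) →
      ≡.subst (λ n → Vec (L × ℕ) (suc n)) eq v ⇄* ((i , m) ∷ (i , k) ∷ u) ×
      ≡.subst (Vec (L × ℕ)) eq w ⇄* ((i , m ℕ.+ k) ∷ u)
  merge-toHead here = _ , _ , _ , ≡.refl , _ , ε , ε
  merge-toHead (there {a = a} s) with merge-toHead s
  ... | m , k , n′ , ≡.refl , u , p , q = m , k , suc n′ , ≡.refl , a ∷ u ,
    gmap (a ∷_) there p ◅◅ here ◅ there here ◅ ε , gmap (a ∷_) there q ◅◅ here ◅ ε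

  det-merge : ∀ {n i} {v : Vec (L × ℕ) (suc n)} {w} → Merge i v w →
              det (weighted v) ≈ d i * det (weighted w)
  det-merge {i = i} {v} {w} s with merge-toHead s
  ... | m , k , n′ , ≡.refl , u , p , q = begin
    det (weighted v)                               ≈⟨ det-⇄* p ⟩
    det (weighted ((i , m) ∷ (i , k) ∷ u))         ≈⟨ det-mergeHead i m k u ⟩
    d i * det (weighted ((i , m ℕ.+ k) ∷ u))       ≈⟨ *-congˡ (det-⇄* q) ⟨
    d i * det (weighted w)                         ∎

  -- v ⟶[ q ] w: merging turns v into w, and the determinant loses the factor q.
  data _⟶[_]_ : ∀ {m n} → Vec (L × ℕ) m → Carrier → Vec (L × ℕ) n → Set (c ⊔ ℓ) where
    done : ∀ {n q} {v : Vec (L × ℕ) n} → q ≈ 1# → v ⟶[ q ] v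
    step : ∀ {m n i q q′} {v : Vec (L × ℕ) (suc m)} {w} {u : Vec (L × ℕ) n} →
           Merge i v w → w ⟶[ q ] u → q′ ≈ d i * q → v ⟶[ q′ ] u

  det-⟶ : ∀ {m n q} {v : Vec (L × ℕ) m} {w : Vec (L × ℕ) n} → v ⟶[ q ] w →
          det (weighted v) ≈ q * det (weighted w)
  det-⟶ (done q≈1) = trans (sym (*-identityˡ _)) (*-congʳ (sym q≈1))
  det-⟶ (step {i = i} {q} {q′} {v} {w} {u} s r q′≈dq) = begin
    det (weighted v)              ≈⟨ det-merge s ⟩
    d i * det (weighted w)        ≈⟨ *-congˡ (det-⟶ r) ⟩
    d i * (q * det (weighted u))  ≈⟨ *-assoc _ _ _ ⟨
    d i * q * det (weighted u)    ≈⟨ *-congʳ q′≈dq ⟨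
    q′ * det (weighted u)         ∎

  ⟶-resp-≈ : ∀ {m n q q′} {v : Vec (L × ℕ) m} {w : Vec (L × ℕ) n} →
             q′ ≈ q → v ⟶[ q ] w → v ⟶[ q′ ] w
  ⟶-resp-≈ eq (done q≈1)   = done (trans eq q≈1)
  ⟶-resp-≈ eq (step s r e) = step s r (trans eq e)

  ⟶-trans : ∀ {m n o q q′} {v : Vec (L × ℕ) m} {w : Vec (L × ℕ) n} {u : Vec (L × ℕ) o} →
            v ⟶[ q ] w → w ⟶[ q′ ] u → v ⟶[ q * q′ ] u
  ⟶-trans (done q≈1)   r′ = ⟶-resp-≈ (trans (*-congʳ q≈1) (*-identityˡ _)) r′
  ⟶-trans (step s r e) r′ = step s (⟶-trans r r′) (trans (*-congʳ e) (*-assoc _ _ _))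

  ⟶-cons : ∀ {m n q a} {v : Vec (L × ℕ) m} {w : Vec (L × ℕ) n} → v ⟶[ q ] w → (a ∷ v) ⟶[ q ] (a ∷ w)
  ⟶-cons (done q≈1)   = done q≈1
  ⟶-cons (step s r e) = step (there s) (⟶-cons r) e

  -- The leading entry absorbs the others one at a time; its weight w is arbitrary so that the
  -- induction can raise it. A block starts with w = 1.
  mergeBlock : ∀ i w m {n} (v : Vec (L × ℕ) n) →
    ((i , w) ∷ replicate m (i , 1) ++ v) ⟶[ d i ^ m ] ((i , w ℕ.+ m) ∷ v)
  mergeBlock i w zero    v rewrite ℕ.+-identityʳ w = done refl
  mergeBlock i w (suc m) v = step here
    (≡.subst (λ k → ((i , w ℕ.+ 1) ∷ replicate m (i , 1) ++ v) ⟶[ d i ^ m ] ((i , k) ∷ v))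
      (ℕ.+-assoc w 1 m) (mergeBlock i (w ℕ.+ 1) m v)) refl

  expanded : ∀ {t} (n : Fin t → ℕ) → (Fin t → L) → Vec (L × ℕ) (sumℕ n)
  expanded {zero}  n f = []
  expanded {suc t} n f = replicate (n zero) (f zero , 1) ++ expanded (λ i → n (suc i))
      (λ i → f (suc i))

  collapsed : ∀ {t} (n : Fin t → ℕ) → (Fin t → L) → Vec (L × ℕ) t
  collapsed n f = tabulate λ i → f i , n i

  mergeBlocks : ∀ {t} (n : Fin t → ℕ) (f : Fin t → L) → (∀ i → 1 ℕ.≤ n i) →
    expanded n f ⟶[ product (λ i → d (f i) ^ (n i ℕ.∸ 1)) ] collapsed n f
  mergeBlocks {zero}  n f 1≤n = done refl
  -- A block of size `suc m` has one absorbing entry and m absorbed ones, whence the exponent n - 1.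
  mergeBlocks {suc t} n f 1≤n with n zero | 1≤n zero
  ... | suc m | _ = ⟶-trans (mergeBlock (f zero) 1 m _)
      (⟶-cons (mergeBlocks _ _ (λ i → 1≤n (suc i))))

  lookup-expanded : ∀ {t} (n : Fin t → ℕ) (f : Fin t → L) i a →
                    lookup (expanded n f) (blockIndex n i a) ≡ (f i , 1)
  lookup-expanded n f zero    a = ≡.trans
    (lookup-++ˡ (replicate (n zero) (f zero , 1)) _ a) (lookup-replicate a (f zero , 1))
  lookup-expanded n f (suc i) a = ≡.trans
    (lookup-++ʳ (replicate (n zero) (f zero , 1)) _ (blockIndex _ i a)) (lookup-expanded _ _ i a)

  det-weighted-blocks : ∀ {t} (n : Fin t → ℕ) (f : Fin t → L) → (∀ i → 1 ℕ.≤ n i) →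
    det (weighted (expanded n f)) ≈
    product (λ i → d (f i) ^ (n i ℕ.∸ 1)) * det (weighted (collapsed n f))
  det-weighted-blocks n f 1≤n = det-⟶ (mergeBlocks n f 1≤n)

-- The determinant of a block matrix.

data BlockView {t} (n : Fin t → ℕ) : Fin (sumℕ n) → Set where
  inBlock : ∀ i (a : Fin (n i)) → BlockView n (blockIndex n i a)

blockView : ∀ {t} (n : Fin t → ℕ) x → BlockView n x
blockView {suc t} n x with splitAt (n zero) x | join-splitAt (n zero) (sumℕ (λ i → n (suc i))) x
... | inj₁ a | ≡.refl = inBlock zero a
... | inj₂ y | ≡.refl with blockView (λ i → n (suc i)) y
...   | inBlock i a = inBlock (suc i) a

module _ {c ℓ} (R : CommutativeRing c ℓ) where
  open CommutativeRing R hiding (zero)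
  open MatrixOps rawRing
  open RawSemiringOps (RawRing.rawSemiring rawRing) using (_^_; product) renaming (_×_ to _·_)
  open Algebra.Properties.Monoid.Mult +-monoid using (×-homo-1)
  open Determinants R
  open import Relation.Binary.Reasoning.Setoid setoid

  -- The two ends of the merging: `A` has weight 1 at every index, the small matrix has weight `n j`
  -- at its column j.
  det-blocks : ∀ {t} (n : Fin t → ℕ) → (∀ i → 1 ℕ.≤ n i) →
    (S : Fin t → Fin t → Carrier) (d : Fin t → Carrier) (A : Matrix Carrier (sumℕ n) (sumℕ n)) →
    (∀ i a j b → A (blockIndex n i a) (blockIndex n j b) ≈
                   S i j + d i * I (blockIndex n i a) (blockIndex n j b)) →
    det A ≈ product (λ i → d i ^ (n i ℕ.∸ 1)) * det (λ i j → n j · S i j + d i * I i j)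
  det-blocks n 1≤n S d A A≈ = begin
    det A
      ≈⟨ det-cong A≈weighted ⟩
    det (weighted (expanded n λ i → i))
      ≈⟨ det-weighted-blocks n _ 1≤n ⟩
    product (λ i → d i ^ (n i ℕ.∸ 1)) * det (weighted (collapsed n λ i → i))
      ≈⟨ *-congˡ (det-cong weighted≈) ⟩
    product (λ i → d i ^ (n i ℕ.∸ 1)) * det (λ i j → n j · S i j + d i * I i j)  ∎
    where
    open WeightedMatrices R S d
    A≈weighted : A ≈ᴹ weighted (expanded n λ i → i)
    A≈weighted x y with blockView n x | blockView n y
    ... | inBlock i a | inBlock j b
      rewrite lookup-expanded n (λ i → i) i a | lookup-expanded n (λ i → i) j b =
      trans (A≈ i a j b) (+-congʳ (sym (×-homo-1 (S i j))))
    weighted≈ : weighted (collapsed n λ i → i) ≈ᴹ (λ i j → n j · S i j + d i * I i j)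
    weighted≈ i j rewrite lookup∘tabulate (λ i → i , n i) i | lookup∘tabulate (λ i → i , n i) j =
        refl

-- Polynomials as coefficient lists form a commutative ring.

module PolynomialRing {c ℓ} (R : CommutativeRing c ℓ) where
  open CommutativeRing R hiding (zero)
  open Polynomials rawRing
  open IntegerSolver R
  open Algebra.Properties.Ring ring using (-0#≈0#)

  infix 4 _≋_
  -- Wrapped in a record so that p and q can be inferred.
  record _≋_ (p q : Poly) : Set ℓ where
    constructor mk≋
    field at : ∀ k → coeff p k ≈ coeff q k
  open _≋_ public

  ≋-setoid : Setoid c ℓ
  ≋-setoid = record
    { Carrier = Poly
    ; _≈_ = _≋_
    ; isEquivalence = record
      { refl  = mk≋ λ k → refl
      ; sym   = λ e → mk≋ λ k → sym (at e k)
      ; trans = λ e f → mk≋ λ k → trans (at e k) (at f k)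
      }
    }

  open Setoid ≋-setoid public using () renaming (refl to ≋-refl; sym to ≋-sym; trans to ≋-trans)
  open import Relation.Binary.Reasoning.Setoid ≋-setoid

  negᴾ : Poly → Poly
  negᴾ = map (λ a → - a)

  scale : Carrier → Poly → Poly
  scale a = map (a *_)

  coeff-+ : ∀ p q k → coeff (p +ᴾ q) k ≈ coeff p k + coeff q k
  coeff-+ []      q       k       = sym (+-identityˡ _)
  coeff-+ (a ∷ p) []      k       = sym (+-identityʳ _)
  coeff-+ (a ∷ p) (b ∷ q) zero    = refl
  coeff-+ (a ∷ p) (b ∷ q) (suc k) = coeff-+ p q k

  coeff-scale : ∀ a p k → coeff (scale a p) k ≈ a * coeff p k
  coeff-scale a []      k       = sym (zeroʳ a)
  coeff-scale a (b ∷ p) zero    = refl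
  coeff-scale a (b ∷ p) (suc k) = coeff-scale a p k

  coeff-neg : ∀ p k → coeff (negᴾ p) k ≈ - coeff p k
  coeff-neg []      k       = sym -0#≈0#
  coeff-neg (b ∷ p) zero    = refl
  coeff-neg (b ∷ p) (suc k) = coeff-neg p k

  ∷-cong : ∀ {a b p q} → a ≈ b → p ≋ q → a ∷ p ≋ b ∷ q
  ∷-cong e f = mk≋ λ { zero → e ; (suc k) → at f k }

  tail≋[] : ∀ {a p} → a ∷ p ≋ [] → p ≋ []
  tail≋[] e = mk≋ λ k → at e (suc k)

  0∷[]≋[] : 0# ∷ [] ≋ []
  0∷[]≋[] = mk≋ λ { zero → refl ; (suc k) → refl }

  private
    via : ∀ {p q} (f g : ℕ → Carrier) → (∀ k → coeff p k ≈ f k) → (∀ k → coeff q k ≈ g k) →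
          (∀ k → f k ≈ g k) → p ≋ q
    via f g p≈f q≈g f≈g = mk≋ λ k → trans (p≈f k) (trans (f≈g k) (sym (q≈g k)))

  +ᴾ-cong : ∀ {p p′ q q′} → p ≋ p′ → q ≋ q′ → p +ᴾ q ≋ p′ +ᴾ q′
  +ᴾ-cong {p} {p′} {q} {q′} e f = via _ _ (coeff-+ p q) (coeff-+ p′ q′)
    λ k → +-cong (at e k) (at f k)

  +ᴾ-congˡ : ∀ p {q q′} → q ≋ q′ → p +ᴾ q ≋ p +ᴾ q′
  +ᴾ-congˡ p f = +ᴾ-cong {p} ≋-refl f

  +ᴾ-congʳ : ∀ {p p′} q → p ≋ p′ → p +ᴾ q ≋ p′ +ᴾ q
  +ᴾ-congʳ q f = +ᴾ-cong f (≋-refl {q})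

  +ᴾ-comm : ∀ p q → p +ᴾ q ≋ q +ᴾ p
  +ᴾ-comm p q = via _ _ (coeff-+ p q) (coeff-+ q p) λ k → +-comm _ _

  +ᴾ-assoc : ∀ p q r → (p +ᴾ q) +ᴾ r ≋ p +ᴾ (q +ᴾ r)
  +ᴾ-assoc p q r = via _ _ (λ k → trans (coeff-+ (p +ᴾ q) r k) (+-congʳ (coeff-+ p q k)))
    (λ k → trans (coeff-+ p (q +ᴾ r) k) (+-congˡ (coeff-+ q r k))) λ k → +-assoc _ _ _

  +ᴾ-identityʳ : ∀ p → p +ᴾ [] ≋ p
  +ᴾ-identityʳ p = ≋-trans (+ᴾ-comm p []) ≋-refl

  negᴾ-cong : ∀ {p q} → p ≋ q → negᴾ p ≋ negᴾ q
  negᴾ-cong {p} {q} e = via _ _ (coeff-neg p) (coeff-neg q) λ k → -‿cong (at e k)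

  negᴾ-inverseʳ : ∀ p → p +ᴾ negᴾ p ≋ []
  negᴾ-inverseʳ p = mk≋ λ k → trans (coeff-+ p (negᴾ p) k)
      (trans (+-congˡ (coeff-neg p k)) (-‿inverseʳ _))

  scale-cong : ∀ {a b p q} → a ≈ b → p ≋ q → scale a p ≋ scale b q
  scale-cong {a} {b} {p} {q} e f = via _ _ (coeff-scale a p) (coeff-scale b q)
    λ k → *-cong e (at f k)

  scale-+ᴾ : ∀ a p q → scale a (p +ᴾ q) ≋ scale a p +ᴾ scale a q
  scale-+ᴾ a p q = via _ _ (λ k → trans (coeff-scale a (p +ᴾ q) k) (*-congˡ (coeff-+ p q k)))
    (λ k → trans (coeff-+ (scale a p) (scale a q) k)
        (+-cong (coeff-scale a p k) (coeff-scale a q k)))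
    λ k → distribˡ _ _ _

  scale-scale : ∀ a b p → scale (a * b) p ≋ scale a (scale b p)
  scale-scale a b p = via _ _ (coeff-scale (a * b) p)
    (λ k → trans (coeff-scale a (scale b p) k) (*-congˡ (coeff-scale b p k))) λ k → *-assoc _ _ _

  scale-0 : ∀ p → scale 0# p ≋ []
  scale-0 p = mk≋ λ k → trans (coeff-scale 0# p k) (zeroˡ _)

  scale-1 : ∀ p → scale 1# p ≋ p
  scale-1 p = mk≋ λ k → trans (coeff-scale 1# p k) (*-identityˡ _)

  interchange : ∀ p q r s → (p +ᴾ q) +ᴾ (r +ᴾ s) ≋ (p +ᴾ r) +ᴾ (q +ᴾ s)
  interchange p q r s = via _ _
    (λ k → trans (coeff-+ (p +ᴾ q) (r +ᴾ s) k) (+-cong (coeff-+ p q k) (coeff-+ r s k)))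
    (λ k → trans (coeff-+ (p +ᴾ r) (q +ᴾ s) k) (+-cong (coeff-+ p r k) (coeff-+ q s k)))
    λ k → solve 4 (λ p q r s → (p :+ q) :+ (r :+ s) := (p :+ r) :+ (q :+ s)) refl (coeff p k)
        (coeff q k) (coeff r k) (coeff s k)

  0∷-+ᴾ : ∀ p q → 0# ∷ (p +ᴾ q) ≋ (0# ∷ p) +ᴾ (0# ∷ q)
  0∷-+ᴾ p q = ∷-cong (sym (+-identityˡ 0#)) ≋-refl

  *ᴾ-congˡ : ∀ p {q q′} → q ≋ q′ → p *ᴾ q ≋ p *ᴾ q′
  *ᴾ-congˡ []      e = ≋-refl
  *ᴾ-congˡ (a ∷ p) e = +ᴾ-cong (scale-cong refl e) (∷-cong refl (*ᴾ-congˡ p e))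

  *ᴾ-zeroʳ : ∀ p → p *ᴾ [] ≋ []
  *ᴾ-zeroʳ []      = ≋-refl
  *ᴾ-zeroʳ (a ∷ p) = ≋-trans (∷-cong refl (*ᴾ-zeroʳ p)) 0∷[]≋[]

  -- The defining clause of `_*ᴾ_` with the factors exchanged; it makes commutativity a plain
  -- induction.
  *ᴾ-∷ : ∀ p b q → p *ᴾ (b ∷ q) ≋ scale b p +ᴾ (0# ∷ p *ᴾ q)
  *ᴾ-∷ []      b q = ≋-sym 0∷[]≋[]
  *ᴾ-∷ (a ∷ p) b q = ∷-cong (+-congʳ (*-comm a b)) (begin
    scale a q +ᴾ p *ᴾ (b ∷ q)                       ≈⟨ +ᴾ-congˡ (scale a q) (*ᴾ-∷ p b q) ⟩
    scale a q +ᴾ (scale b p +ᴾ (0# ∷ p *ᴾ q))       ≈⟨ +ᴾ-assoc (scale a q) (scale b p) _ ⟨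
    (scale a q +ᴾ scale b p) +ᴾ (0# ∷ p *ᴾ q)
      ≈⟨ +ᴾ-congʳ _ (+ᴾ-comm (scale a q) (scale b p)) ⟩
    (scale b p +ᴾ scale a q) +ᴾ (0# ∷ p *ᴾ q)       ≈⟨ +ᴾ-assoc (scale b p) (scale a q) _ ⟩
    scale b p +ᴾ (scale a q +ᴾ (0# ∷ p *ᴾ q))       ∎)

  *ᴾ-comm : ∀ p q → p *ᴾ q ≋ q *ᴾ p
  *ᴾ-comm []      q = ≋-sym (*ᴾ-zeroʳ q)
  *ᴾ-comm (a ∷ p) q = ≋-trans (+ᴾ-congˡ (scale a q) (∷-cong refl (*ᴾ-comm p q)))
      (≋-sym (*ᴾ-∷ q a p))

  -- Recursion on the first factor would have to compare lists of different lengths; commutativity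
  -- moves each congruence to the second factor.
  *ᴾ-cong : ∀ {p p′ q q′} → p ≋ p′ → q ≋ q′ → p *ᴾ q ≋ p′ *ᴾ q′
  *ᴾ-cong {p} {p′} {q} {q′} e f = begin
    p *ᴾ q    ≈⟨ *ᴾ-congˡ p f ⟩
    p *ᴾ q′   ≈⟨ *ᴾ-comm p q′ ⟩
    q′ *ᴾ p   ≈⟨ *ᴾ-congˡ q′ e ⟩
    q′ *ᴾ p′  ≈⟨ *ᴾ-comm q′ p′ ⟩
    p′ *ᴾ q′  ∎

  *ᴾ-distribˡ : ∀ p q r → p *ᴾ (q +ᴾ r) ≋ p *ᴾ q +ᴾ p *ᴾ r
  *ᴾ-distribˡ []      q r = ≋-refl
  *ᴾ-distribˡ (a ∷ p) q r = begin
    scale a (q +ᴾ r) +ᴾ (0# ∷ p *ᴾ (q +ᴾ r))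
      ≈⟨ +ᴾ-cong (scale-+ᴾ a q r)
          (≋-trans (∷-cong refl (*ᴾ-distribˡ p q r)) (0∷-+ᴾ (p *ᴾ q) (p *ᴾ r))) ⟩
    (scale a q +ᴾ scale a r) +ᴾ ((0# ∷ p *ᴾ q) +ᴾ (0# ∷ p *ᴾ r))
      ≈⟨ interchange (scale a q) (scale a r) _ _ ⟩
    (scale a q +ᴾ (0# ∷ p *ᴾ q)) +ᴾ (scale a r +ᴾ (0# ∷ p *ᴾ r)) ∎

  *ᴾ-distribʳ : ∀ p q r → (q +ᴾ r) *ᴾ p ≋ q *ᴾ p +ᴾ r *ᴾ p
  *ᴾ-distribʳ p q r = begin
    (q +ᴾ r) *ᴾ p        ≈⟨ *ᴾ-comm (q +ᴾ r) p ⟩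
    p *ᴾ (q +ᴾ r)        ≈⟨ *ᴾ-distribˡ p q r ⟩
    p *ᴾ q +ᴾ p *ᴾ r     ≈⟨ +ᴾ-cong (*ᴾ-comm p q) (*ᴾ-comm p r) ⟩
    q *ᴾ p +ᴾ r *ᴾ p     ∎

  0∷-*ᴾ : ∀ p q → (0# ∷ p) *ᴾ q ≋ 0# ∷ p *ᴾ q
  0∷-*ᴾ p q = +ᴾ-congʳ (0# ∷ p *ᴾ q) (scale-0 q)

  scale-*ᴾ : ∀ a p q → scale a p *ᴾ q ≋ scale a (p *ᴾ q)
  scale-*ᴾ a []      q = ≋-refl
  scale-*ᴾ a (b ∷ p) q = begin
    scale (a * b) q +ᴾ (0# ∷ scale a p *ᴾ q)
      ≈⟨ +ᴾ-cong (scale-scale a b q) (∷-cong (sym (zeroʳ a)) (scale-*ᴾ a p q)) ⟩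
    scale a (scale b q) +ᴾ scale a (0# ∷ p *ᴾ q)        ≈⟨ scale-+ᴾ a (scale b q) _ ⟨
    scale a (scale b q +ᴾ (0# ∷ p *ᴾ q))                ∎

  *ᴾ-assoc : ∀ p q r → (p *ᴾ q) *ᴾ r ≋ p *ᴾ (q *ᴾ r)
  *ᴾ-assoc []      q r = ≋-refl
  *ᴾ-assoc (a ∷ p) q r = begin
    (scale a q +ᴾ (0# ∷ p *ᴾ q)) *ᴾ r           ≈⟨ *ᴾ-distribʳ r (scale a q) (0# ∷ p *ᴾ q) ⟩
    scale a q *ᴾ r +ᴾ (0# ∷ p *ᴾ q) *ᴾ r
      ≈⟨ +ᴾ-cong (scale-*ᴾ a q r) (≋-trans (0∷-*ᴾ (p *ᴾ q) r) (∷-cong refl (*ᴾ-assoc p q r))) ⟩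
    scale a (q *ᴾ r) +ᴾ (0# ∷ p *ᴾ (q *ᴾ r))    ∎

  *ᴾ-identityˡ : ∀ p → (1# ∷ []) *ᴾ p ≋ p
  *ᴾ-identityˡ p = ≋-trans (+ᴾ-cong (scale-1 p) 0∷[]≋[]) (+ᴾ-identityʳ p)

  ≋-commutativeRing : CommutativeRing c ℓ
  ≋-commutativeRing = record
    { _≈_ = _≋_ ; _+_ = _+ᴾ_ ; _*_ = _*ᴾ_ ; -_ = negᴾ ; 0# = [] ; 1# = 1# ∷ []
    ; isCommutativeRing = record
      { isRing = record
        { +-isAbelianGroup = record
          { isGroup = record
            { isMonoid = record
              { isSemigroup = record
                { isMagma = record
                    { isEquivalence = Setoid.isEquivalence ≋-setoid ; ∙-cong = +ᴾ-cong }
                ; assoc = +ᴾ-assoc }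
              ; identity = (λ p → ≋-refl) , +ᴾ-identityʳ }
            ; inverse = (λ p → ≋-trans (+ᴾ-comm (negᴾ p) p) (negᴾ-inverseʳ p)) , negᴾ-inverseʳ
            ; ⁻¹-cong = negᴾ-cong }
          ; comm = +ᴾ-comm }
        ; *-cong = *ᴾ-cong
        ; *-assoc = *ᴾ-assoc
        ; *-identity = *ᴾ-identityˡ , λ p → ≋-trans (*ᴾ-comm p _) (*ᴾ-identityˡ p)
        ; distrib = *ᴾ-distribˡ , *ᴾ-distribʳ }
      ; *-comm = *ᴾ-comm } }

  -- The same ring, now with polyRawRing itself as the underlying raw ring: det
  -- and charPoly refer to it.
  polyCommutativeRing : CommutativeRing c ℓ
  polyCommutativeRing = record
    { RawRing polyRawRing
    ; isCommutativeRing = record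
      { isRing = record
        { +-isAbelianGroup = record
          { isGroup = record
            { isMonoid = record
              { isSemigroup = record
                { isMagma = record
                  { isEquivalence = record
                    { refl  = λ k → refl
                    ; sym   = λ e k → sym (e k)
                    ; trans = λ e f k → trans (e k) (f k) }
                  ; ∙-cong = λ {p} {q} {r} {s} e f → at (P.+-cong {p} {q} {r} {s} (mk≋ e) (mk≋ f)) }
                ; assoc = λ p q r → at (P.+-assoc p q r) }
              ; identity = (λ p → at (P.+-identityˡ p)) , λ p → at (P.+-identityʳ p) }
            ; inverse = (λ p → at (P.-‿inverseˡ p)) , λ p → at (P.-‿inverseʳ p)
            ; ⁻¹-cong = λ {p} {q} e → at (P.-‿cong {p} {q} (mk≋ e)) }
          ; comm = λ p q → at (P.+-comm p q) }
        ; *-cong = λ {p} {q} {r} {s} e f → at (P.*-cong {p} {q} {r} {s} (mk≋ e) (mk≋ f))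
        ; *-assoc = λ p q r → at (P.*-assoc p q r)
        ; *-identity = (λ p → at (P.*-identityˡ p)) , λ p → at (P.*-identityʳ p)
        ; distrib = (λ p q r → at (P.distribˡ p q r)) , λ p q r → at (P.distribʳ p q r) }
      ; *-comm = λ p q → at (P.*-comm p q) } }
    where module P = CommutativeRing ≋-commutativeRing

-- Division by X - z and multiplicities of roots.

module LinearFactors {c ℓ} (R : CommutativeRing c ℓ) where
  open CommutativeRing R hiding (zero)
  open Polynomials rawRing
  open PolynomialRing R
  open IntegerSolver R
  open import Relation.Binary.Reasoning.Setoid setoid

  -- Horner's rule, hence also the remainder of synthetic division. Together with `quotient` it
  -- splits `divideByLinear` into two plain recursions.
  eval : Carrier → Poly → Carrier
  eval z []      = 0#
  eval z (a ∷ p) = a + z * eval z p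

  quotient : Carrier → Poly → Poly
  quotient z []      = []
  quotient z (a ∷ p) = eval z p ∷ quotient z p

  divideByLinear≡ : ∀ z p → divideByLinear z p ≡ (quotient z p , eval z p)
  divideByLinear≡ z []      = ≡.refl
  divideByLinear≡ z (a ∷ p) rewrite divideByLinear≡ z p = ≡.refl

  linear : Carrier → Poly
  linear z = X +ᴾ negᴾ (C z)

  eval-zero : ∀ z {p} → p ≋ [] → eval z p ≈ 0#
  eval-zero z {[]}    e = refl
  eval-zero z {a ∷ p} e = begin
    a + z * eval z p    ≈⟨ +-cong (at e 0) (*-congˡ (eval-zero z (tail≋[] e))) ⟩
    0# + z * 0#         ≈⟨ trans (+-identityˡ _) (zeroʳ z) ⟩
    0#                  ∎

  eval-cong : ∀ z {p q} → p ≋ q → eval z p ≈ eval z q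
  eval-cong z {[]}    {q}     e = sym (eval-zero z (≋-sym e))
  eval-cong z {a ∷ p} {[]}    e = eval-zero z e
  eval-cong z {a ∷ p} {b ∷ q} e = +-cong (at e 0) (*-congˡ (eval-cong z {p} {q} (mk≋ (at e ∘ suc))))

  eval-+ : ∀ z p q → eval z (p +ᴾ q) ≈ eval z p + eval z q
  eval-+ z []      q       = sym (+-identityˡ _)
  eval-+ z (a ∷ p) []      = sym (+-identityʳ _)
  eval-+ z (a ∷ p) (b ∷ q) = trans (+-congˡ (*-congˡ (eval-+ z p q)))
    (solve 5 (λ a b z p q → (a :+ b) :+ z :* (p :+ q) := (a :+ z :* p) :+ (b :+ z :* q))
        refl a b z _ _)

  eval-scale : ∀ z a p → eval z (scale a p) ≈ a * eval z p
  eval-scale z a []      = sym (zeroʳ a)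
  eval-scale z a (b ∷ p) = trans (+-congˡ (*-congˡ (eval-scale z a p)))
    (solve 4 (λ a b z p → a :* b :+ z :* (a :* p) := a :* (b :+ z :* p)) refl a b z _)

  eval-* : ∀ z p q → eval z (p *ᴾ q) ≈ eval z p * eval z q
  eval-* z []      q = sym (zeroˡ _)
  eval-* z (a ∷ p) q = begin
    eval z (scale a q +ᴾ (0# ∷ p *ᴾ q))                ≈⟨ eval-+ z (scale a q) _ ⟩
    eval z (scale a q) + (0# + z * eval z (p *ᴾ q))
      ≈⟨ +-cong (eval-scale z a q) (trans (+-identityˡ _) (*-congˡ (eval-* z p q))) ⟩
    a * eval z q + z * (eval z p * eval z q)
      ≈⟨ solve 4 (λ a z p q → a :* q :+ z :* (p :* q) := (a :+ z :* p) :* q) refl a z _ _ ⟩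
    (a + z * eval z p) * eval z q                      ∎

  eval-linear : ∀ z w → eval z (linear w) ≈ z - w
  eval-linear z w = begin
    (0# - w) + z * (1# + z * 0#)
      ≈⟨ +-cong (+-identityˡ _) (*-congˡ (trans (+-congˡ (zeroʳ z)) (+-identityʳ 1#))) ⟩
    - w + z * 1#                    ≈⟨ +-comm _ _ ⟩
    z * 1# - w                      ≈⟨ +-congʳ (*-identityʳ z) ⟩
    z - w                           ∎

  quotient-zero : ∀ z {p} → p ≋ [] → quotient z p ≋ []
  quotient-zero z {[]}    e = ≋-refl
  quotient-zero z {a ∷ p} e =
    ≋-trans (∷-cong (eval-zero z (tail≋[] e)) (quotient-zero z (tail≋[] e))) 0∷[]≋[]

  private
    coeff-linear*-tail : ∀ q k → coeff (scale 1# q +ᴾ (0# ∷ [])) k ≈ coeff q k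
    coeff-linear*-tail q k = at (≋-trans (+ᴾ-cong (scale-1 q) 0∷[]≋[]) (+ᴾ-identityʳ q)) k

  coeff-linear*-zero : ∀ z q → coeff (linear z *ᴾ q) 0 ≈ - (z * coeff q 0)
  coeff-linear*-zero z q = begin
    coeff (linear z *ᴾ q) 0                ≈⟨ coeff-+ (scale (0# - z) q) _ 0 ⟩
    coeff (scale (0# - z) q) 0 + 0#        ≈⟨ +-identityʳ _ ⟩
    coeff (scale (0# - z) q) 0             ≈⟨ coeff-scale (0# - z) q 0 ⟩
    (0# - z) * coeff q 0                   ≈⟨ *-congʳ (+-identityˡ _) ⟩
    - z * coeff q 0                        ≈⟨ solve 2 (λ z a → :- z :* a := :- (z :* a)) refl z _ ⟩
    - (z * coeff q 0)                      ∎

  coeff-linear*-suc : ∀ z q k → coeff (linear z *ᴾ q) (suc k) ≈ coeff q k - z * coeff q (suc k)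
  coeff-linear*-suc z q k = begin
    coeff (linear z *ᴾ q) (suc k)
      ≈⟨ coeff-+ (scale (0# - z) q) _ (suc k) ⟩
    coeff (scale (0# - z) q) (suc k) + coeff (scale 1# q +ᴾ (0# ∷ [])) k
      ≈⟨ +-cong (trans (coeff-scale (0# - z) q (suc k)) (*-congʳ (+-identityˡ _)))
          (coeff-linear*-tail q k) ⟩
    - z * coeff q (suc k) + coeff q k
      ≈⟨ solve 3 (λ z a b → :- z :* a :+ b := b :- z :* a) refl z _ _ ⟩
    coeff q k - z * coeff q (suc k) ∎

  coeff-quotient-zero : ∀ z p → coeff p 0 ≈ eval z p - z * coeff (quotient z p) 0
  coeff-quotient-zero z []      = sym (trans (+-congˡ (-‿cong (zeroʳ z))) (-‿inverseʳ 0#))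
  coeff-quotient-zero z (a ∷ p) = solve 2 (λ a b → a := (a :+ b) :- b) refl a (z * eval z p)

  coeff-quotient-suc : ∀ z p k → coeff p (suc k) ≈
                       coeff (quotient z p) k - z * coeff (quotient z p) (suc k)
  coeff-quotient-suc z []      k       = sym (trans (+-congˡ (-‿cong (zeroʳ z))) (-‿inverseʳ 0#))
  coeff-quotient-suc z (a ∷ p) zero    = coeff-quotient-zero z p
  coeff-quotient-suc z (a ∷ p) (suc k) = coeff-quotient-suc z p k

  -- Synthetic division yields p_(k+1) = q_k - z q_(k+1), the same rule as for the coefficients of
  -- (X - z) q. Only the constant term differs, by the remainder, which vanishes here.
  factor-theorem : ∀ z p → eval z p ≈ 0# → p ≋ linear z *ᴾ quotient z p
  factor-theorem z p root = mk≋ λ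
    { zero → begin
        coeff p 0                                  ≈⟨ coeff-quotient-zero z p ⟩
        eval z p - z * coeff (quotient z p) 0      ≈⟨ +-congʳ root ⟩
        0# - z * coeff (quotient z p) 0            ≈⟨ +-identityˡ _ ⟩
        - (z * coeff (quotient z p) 0)             ≈⟨ coeff-linear*-zero z (quotient z p) ⟨
        coeff (linear z *ᴾ quotient z p) 0         ∎
    ; (suc k) → trans (coeff-quotient-suc z p k) (sym (coeff-linear*-suc z (quotient z p) k)) }

  private
    -- The coefficients of p are determined by the next ones, and eventually vanish.
    backwards-zero : ∀ z p → (∀ k → coeff p k ≈ z * coeff p (suc k)) → p ≋ []
    backwards-zero z []      rec = ≋-refl
    backwards-zero z (a ∷ p) rec = ≋-trans (∷-cong a≈0 p≋[]) 0∷[]≋[]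
      where
      p≋[] = backwards-zero z p (rec ∘ suc)
      a≈0 = trans (rec 0) (trans (*-congˡ (at p≋[] 0)) (zeroʳ z))

  -- X - z is monic: for r = p - q, (X - z) r = 0 gives r_k = z r_(k+1), and the coefficients of a
  -- list are eventually zero.
  linear-cancel : ∀ z p q → linear z *ᴾ p ≋ linear z *ᴾ q → p ≋ q
  linear-cancel z p q e = mk≋ λ k → P.x∙y⁻¹≈ε⇒x≈y p q p-q≋[] .at k
    where
    module P = Algebra.Properties.Ring (CommutativeRing.ring ≋-commutativeRing)
    open CommutativeRing ≋-commutativeRing using () renaming (_-_ to _-ᴾ_)
    linear*[p-q]≋[] : linear z *ᴾ (p -ᴾ q) ≋ []
    linear*[p-q]≋[] = ≋-trans (P.x[y-z]≈xy-xz (linear z) p q) (P.x≈y⇒x∙y⁻¹≈ε e)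
    p-q≋[] : p -ᴾ q ≋ []
    p-q≋[] = backwards-zero z (p -ᴾ q) λ k → begin
      coeff r k
        ≈⟨ solve 2 (λ x y → x := (x :- y) :+ y) refl _ (z * coeff r (suc k)) ⟩
      (coeff r k - z * coeff r (suc k)) + z * coeff r (suc k) ≈⟨ +-congʳ (coeff-linear*-suc z r k) ⟨
      coeff (linear z *ᴾ r) (suc k) + z * coeff r (suc k)
        ≈⟨ +-congʳ (at linear*[p-q]≋[] (suc k)) ⟩
      0# + z * coeff r (suc k)                                ≈⟨ +-identityˡ _ ⟩
      z * coeff r (suc k)                                     ∎
      where r = p -ᴾ q

  VanishesFrom : ℕ → Poly → Set ℓ
  VanishesFrom k p = ∀ {j} → k ℕ.≤ j → coeff p j ≈ 0#

  vanishesFrom-length : ∀ p → VanishesFrom (length p) p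
  vanishesFrom-length []      _         = refl
  vanishesFrom-length (a ∷ p) (s≤s le)  = vanishesFrom-length p le

  vanishesFrom-quotient : ∀ z {k} p → VanishesFrom (suc k) p → VanishesFrom k (quotient z p)
  vanishesFrom-quotient z         []      v _        = refl
  vanishesFrom-quotient z {zero}  (a ∷ p) v {j} _    = at
      (≋-trans (∷-cong (eval-zero z p≋[]) (quotient-zero z p≋[])) 0∷[]≋[]) j
    where p≋[] = mk≋ {p = p} {q = []} λ k → v {suc k} (s≤s z≤n)
  vanishesFrom-quotient z {suc k} (a ∷ p) v (s≤s le) =
    vanishesFrom-quotient z p (λ le → v (s≤s le)) le

  module Multiplicities (_≟_ : Decidable _≈_)
    (noZeroDivisors : ∀ x y → x ≉ 0# → x * y ≈ 0# → y ≈ 0#)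
    (0≉1 : 0# ≉ 1#) where
    open Roots _≟_

    -- A certificate: m factors X - z are split off and what is left does not vanish at z. The
    -- factors are given up to `_≋_`, so it does not depend on the lists chosen.
    data Multiplicity (z : Carrier) : ℕ → Poly → Set (c ⊔ ℓ) where
      isNonroot : ∀ {p} → eval z p ≉ 0# → Multiplicity z 0 p
      isRoot : ∀ {m p q} → p ≋ linear z *ᴾ q → Multiplicity z m q → Multiplicity z (suc m) p

    eval-linear* : ∀ z {p q} → p ≋ linear z *ᴾ q → eval z p ≈ 0#
    eval-linear* z {p} {q} e = trans (eval-cong z e) (trans (eval-* z (linear z) q)
      (trans (*-congʳ (trans (eval-linear z z) (-‿inverseʳ z))) (zeroˡ _)))

    -- Two chains are shortened in parallel by cancelling X - z; they end together because a
    -- multiple of X - z vanishes at z.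
    multiplicity-unique : ∀ {z m m′ p p′} → p ≋ p′ → Multiplicity z m p → Multiplicity z m′ p′ →
                          m ≡ m′
    multiplicity-unique e (isNonroot p≉0)  (isNonroot _)      = ≡.refl
    multiplicity-unique {z} e (isNonroot p≉0)  (isRoot f m)    = contradiction
        (eval-linear* z (≋-trans e f)) p≉0
    multiplicity-unique {z} e (isRoot f m)  (isNonroot p≉0)    = contradiction
        (eval-linear* z (≋-trans (≋-sym e) f)) p≉0
    multiplicity-unique {z} e (isRoot {q = q} f m) (isRoot {q = q′} f′ m′) = ≡.cong suc
      (multiplicity-unique (linear-cancel z q q′ (≋-trans (≋-sym f) (≋-trans e f′))) m m′)

    -- The factors X - z are split off from p, then from q. The two remaining values at z are
    -- nonzero, and so is their product.
    multiplicity-* : ∀ {z m n p q} → Multiplicity z m p → Multiplicity z n q →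
                     Multiplicity z (m ℕ.+ n) (p *ᴾ q)
    multiplicity-* {z} {p = p} {q} (isNonroot p≉0) (isNonroot q≉0) = isNonroot λ pq≈0 →
      q≉0 (noZeroDivisors _ _ p≉0 (trans (sym (eval-* z p q)) pq≈0))
    multiplicity-* {z} {p = p} (isNonroot p≉0) (isRoot {m} {q} {q′} e n) = isRoot
      (≋-trans (*ᴾ-congˡ p e)
          (S.solve 3 (λ p l q → p S.:* (l S.:* q) S.:= l S.:* (p S.:* q)) ≋-refl p (linear z) q′))
      (multiplicity-* {m = 0} {p = p} (isNonroot p≉0) n)
      where module S = IntegerSolver ≋-commutativeRing
    multiplicity-* {z} {q = q} (isRoot {q = p′} e m) n = isRoot
      (≋-trans (*ᴾ-cong e (≋-refl {q})) (*ᴾ-assoc (linear z) p′ q)) (multiplicity-* m n)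

    multiplicity-1 : ∀ z → Multiplicity z 0 (1# ∷ [])
    multiplicity-1 z = isNonroot λ e → 0≉1
        (sym (trans (sym (trans (+-congˡ (zeroʳ z)) (+-identityʳ 1#))) e))

    multiplicity-linear-root : ∀ {z w} → w ≈ z → Multiplicity z 1 (linear w)
    multiplicity-linear-root {z} {w} w≈z = isRoot
      (≋-trans (∷-cong (+-congˡ (-‿cong w≈z)) ≋-refl)
          (≋-sym (≋-trans (*ᴾ-comm (linear z) (1# ∷ [])) (*ᴾ-identityˡ (linear z)))))
      (multiplicity-1 z)

    multiplicity-linear-nonroot : ∀ {z w} → w ≉ z → Multiplicity z 0 (linear w)
    multiplicity-linear-nonroot {z} {w} w≉z = isNonroot λ e →
      w≉z (sym (x∙y⁻¹≈ε⇒x≈y z w (trans (sym (eval-linear z w)) e)))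
      where
      open Algebra.Properties.Ring ring

    -- Each division by X - z lowers the bound on the degree together with the bound on the number
    -- of divisions. Reaching 0 would make the polynomial zero, but quotients of a nonzero
    -- polynomial by its linear factors are nonzero.
    timesDivisible-multiplicity : ∀ z k p → ¬ p ≋ [] → VanishesFrom k p →
                                  Multiplicity z (timesDivisible k z p) p
    timesDivisible-multiplicity z zero    p p≉0 v = contradiction (mk≋ λ k → v z≤n) p≉0
    timesDivisible-multiplicity z (suc k) p p≉0 v rewrite divideByLinear≡ z p with eval z p ≟ 0#
    ... | yes root = isRoot (factor-theorem z p root)
            (timesDivisible-multiplicity z k (quotient z p) q≉0 (vanishesFrom-quotient z p v))
      where
      q≉0 : ¬ quotient z p ≋ []
      q≉0 e = p≉0 (≋-trans (factor-theorem z p root)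
          (≋-trans (*ᴾ-congˡ (linear z) e) (*ᴾ-zeroʳ (linear z))))
    ... | no ¬root = isNonroot ¬root

    rootMultiplicity-multiplicity : ∀ z p → ¬ p ≋ [] → Multiplicity z (rootMultiplicity z p) p
    rootMultiplicity-multiplicity z p p≉0 =
      timesDivisible-multiplicity z (length p) p p≉0 (vanishesFrom-length p)

    multiplicity⇒nonzero : ∀ {z m p} → Multiplicity z m p → ¬ p ≋ []
    multiplicity⇒nonzero {z} (isNonroot p≉0) e = p≉0 (eval-zero z e)
    multiplicity⇒nonzero {z} (isRoot {q = q} f m) e = multiplicity⇒nonzero m
      (linear-cancel z q [] (≋-trans (≋-sym f) (≋-trans e (≋-sym (*ᴾ-zeroʳ (linear z))))))

    rootMultiplicity-unique : ∀ {z m p q} → p ≋ q → Multiplicity z m q → rootMultiplicity z p ≡ m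
    rootMultiplicity-unique {z} {p = p} e m = multiplicity-unique e
      (rootMultiplicity-multiplicity z p λ p≋[] → multiplicity⇒nonzero m (≋-trans (≋-sym e) p≋[])) m

-- Characteristic polynomials are nonzero.

module LeadingCoefficients {c ℓ} (R : CommutativeRing c ℓ) where
  open CommutativeRing R hiding (zero)
  open Polynomials rawRing
  open PolynomialRing R
  open LinearFactors R
  open RawSemiringOps (RawRing.rawSemiring rawRing) using (sum; _^_)
  module Pᴿ = RawSemiringOps (RawRing.rawSemiring polyRawRing)
  module M = MatrixOps rawRing
  module Mᴾ = MatrixOps polyRawRing
  open import Relation.Binary.Reasoning.Setoid setoid

  -- The coefficient `a` may be `0#`: this is a degree bound with its top coefficient, so it remains
  -- valid when sums cancel.
  record HasLeading (n : ℕ) (p : Poly) (a : Carrier) : Set ℓ where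
    constructor leading
    field
      coeff≈   : coeff p n ≈ a
      vanishes : VanishesFrom (suc n) p
  open HasLeading

  leading-sum : ∀ {k n} (p : Fin k → Poly) (a : Fin k → Carrier) →
                (∀ i → HasLeading n (p i) (a i)) → HasLeading n (Pᴿ.sum p) (sum a)
  leading-sum {zero}  p a h = leading refl λ _ → refl
  leading-sum {suc k} p a h = leading
    (trans (coeff-+ (p zero) _ _) (+-cong (coeff≈ (h zero)) (coeff≈ rest)))
    λ le → trans (coeff-+ (p zero) _ _)
        (trans (+-cong (vanishes (h zero) le) (vanishes rest le)) (+-identityˡ 0#))
    where rest = leading-sum (λ i → p (suc i)) (λ i → a (suc i)) (λ i → h (suc i))

  leading-* : ∀ m {n} p {q a b} → HasLeading m p a → HasLeading n q b →
              HasLeading (m ℕ.+ n) (p *ᴾ q) (a * b)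
  leading-* m [] h h′ = leading (trans (sym (zeroˡ _)) (*-congʳ (coeff≈ h))) λ _ → refl
  leading-* zero {n} (x ∷ p) {q} {a} {b} h h′ = leading
    (trans (coeff-xq n) (*-cong (coeff≈ h) (coeff≈ h′)))
    λ {j} le → trans (coeff-xq j) (trans (*-congˡ (vanishes h′ le)) (zeroʳ x))
    where
    p≋[] = mk≋ {p = p} {q = []} λ k → vanishes h {suc k} (s≤s z≤n)
    coeff-xq : ∀ k → coeff ((x ∷ p) *ᴾ q) k ≈ x * coeff q k
    coeff-xq k = begin
      coeff (scale x q +ᴾ (0# ∷ p *ᴾ q)) k            ≈⟨ coeff-+ (scale x q) _ k ⟩
      coeff (scale x q) k + coeff (0# ∷ p *ᴾ q) k
        ≈⟨ +-cong (coeff-scale x q k)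
            (at (≋-trans (∷-cong refl (*ᴾ-cong p≋[] (≋-refl {q}))) 0∷[]≋[]) k) ⟩
      x * coeff q k + 0#                              ≈⟨ +-identityʳ _ ⟩
      x * coeff q k                                   ∎
  leading-* (suc m) {n} (x ∷ p) {q} {a} {b} h h′ = leading
    (trans (shift (ℕ.m≤n+m n m)) (coeff≈ rest))
    λ { {suc j} (s≤s le) → trans (shift (ℕ.≤-trans (ℕ.≤-trans (ℕ.m≤n+m n m) (ℕ.n≤1+n _)) le))
        (vanishes rest le) }
    where
    rest = leading-* m p {q} {a} {b} (leading (coeff≈ h) λ le → vanishes h (s≤s le)) h′
    -- The summand x q ends at position n, so beyond it only the shifted product p q contributes.
    shift : ∀ {k} → n ℕ.≤ k → coeff ((x ∷ p) *ᴾ q) (suc k) ≈ coeff (p *ᴾ q) k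
    shift {k} le = begin
      coeff (scale x q +ᴾ (0# ∷ p *ᴾ q)) (suc k)          ≈⟨ coeff-+ (scale x q) _ (suc k) ⟩
      coeff (scale x q) (suc k) + coeff (p *ᴾ q) k        ≈⟨ +-congʳ (coeff-scale x q (suc k)) ⟩
      x * coeff q (suc k) + coeff (p *ᴾ q) k
        ≈⟨ +-congʳ (trans (*-congˡ (vanishes h′ (s≤s le))) (zeroʳ x)) ⟩
      0# + coeff (p *ᴾ q) k                               ≈⟨ +-identityˡ _ ⟩
      coeff (p *ᴾ q) k                                    ∎

  leading-const : ∀ a → HasLeading 0 (a ∷ []) a
  leading-const a = leading refl λ { (s≤s _) → refl }

  leading-sign : ∀ k → HasLeading 0 (negᴾ (1# ∷ []) Pᴿ.^ k) ((- 1#) ^ k)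
  leading-sign zero    = leading-const 1#
  leading-sign (suc k) = leading-* 0 (negᴾ (1# ∷ [])) (leading-const (- 1#)) (leading-sign k)

  -- Every product in the expansion has n entries of degree at most 1 and signs of degree 0, so its
  -- coefficient of X^n is the product of the linear coefficients.
  leading-det : ∀ {n} (A : Matrix Poly n n) (U : Matrix Carrier n n) →
                (∀ i j → HasLeading 1 (A i j) (U i j)) → HasLeading n (Mᴾ.det A) (M.det U)
  leading-det {zero}  A U h = leading-const 1#
  leading-det {suc n} A U h = leading-sum _ _ λ j →
    leading-* 1 (negᴾ (1# ∷ []) Pᴿ.^ toℕ j *ᴾ A zero j)
      (leading-* 0 (negᴾ (1# ∷ []) Pᴿ.^ toℕ j) (leading-sign (toℕ j)) (h zero j))
      (leading-det (Mᴾ.minor A zero j) (M.minor U zero j) λ a b → h (suc a) (punchIn j b))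

  -- The linear coefficients of X I - A form the identity matrix, so the coefficient of X^n is det
  -- I.
  charPoly-nonzero : 0# ≉ 1# → ∀ {n} (A : Matrix Carrier n n) → ¬ charPoly A ≋ []
  charPoly-nonzero 0≉1 {n} A e = 0≉1 (begin
    0#                     ≈⟨ at e n ⟨
    coeff (charPoly A) n   ≈⟨ coeff≈ (leading-det _ M.I entries) ⟩
    M.det (M.I {n})        ≈⟨ Determinants.det-I R n ⟩
    1#                     ∎)
    where
    entries : ∀ i j → HasLeading 1 ((X *ᴾ Mᴾ.I i j) +ᴾ negᴾ (C (A i j))) (M.I i j)
    entries i j with ⌊ i ≟ᶠ j ⌋
    ... | true  = leading (trans (+-identityʳ _) (*-identityˡ 1#)) λ { (s≤s (s≤s _)) → refl }
    ... | false = leading refl λ { (s≤s (s≤s _)) → refl }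

-- The identity matrix in block coordinates.

-- The positions a and b live in different types until the blocks are known to agree, hence an
-- equation of dependent pairs. Distinct blocks are told apart by `splitAt`.
blockIndex-injective : ∀ {t} (n : Fin t → ℕ) {i j a b} → blockIndex n i a ≡ blockIndex n j b →
                       _≡_ {A = ∃ λ i → Fin (n i)} (i , a) (j , b)
blockIndex-injective n {zero}  {zero}  {a} {b} eq with ↑ˡ-injective _ a b eq
... | ≡.refl = ≡.refl
blockIndex-injective n {zero}  {suc j} {a} {b} eq with () ←
  ≡.trans (≡.sym (splitAt-↑ˡ (n zero) a _))
      (≡.trans (≡.cong (splitAt (n zero)) eq) (splitAt-↑ʳ (n zero) _ (blockIndex (n ∘ suc) j b)))
blockIndex-injective n {suc i} {zero}  {a} {b} eq with () ←
  ≡.trans (≡.sym (splitAt-↑ˡ (n zero) b _))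
      (≡.trans (≡.cong (splitAt (n zero)) (≡.sym eq))
      (splitAt-↑ʳ (n zero) _ (blockIndex (n ∘ suc) i a)))
blockIndex-injective n {suc i} {suc j} {a} {b} eq
  with blockIndex-injective (n ∘ suc) {i} {j} {a} {b} (↑ʳ-injective (n zero) _ _ eq)
... | ≡.refl = ≡.refl

⌊blockIndex≟blockIndex⌋ : ∀ {t} (n : Fin t → ℕ) i (a b : Fin (n i)) →
  ⌊ blockIndex n i a ≟ᶠ blockIndex n i b ⌋ ≡ ⌊ a ≟ᶠ b ⌋
⌊blockIndex≟blockIndex⌋ n i a b with blockIndex n i a ≟ᶠ blockIndex n i b | a ≟ᶠ b
... | yes _  | yes _      = ≡.refl
... | no  _  | no _       = ≡.refl
... | no ¬eq | yes ≡.refl = contradiction ≡.refl ¬eq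
... | yes eq | no a≢b with blockIndex-injective n {i} {i} {a} {b} eq
...   | ≡.refl = contradiction ≡.refl a≢b

⌊blockIndex≟blockIndex⌋-distinct : ∀ {t} (n : Fin t → ℕ) {i j} a b → i ≢ j →
  ⌊ blockIndex n i a ≟ᶠ blockIndex n j b ⌋ ≡ false
⌊blockIndex≟blockIndex⌋-distinct n {i} {j} a b i≢j with blockIndex n i a ≟ᶠ blockIndex n j b
... | yes eq = contradiction (≡.cong proj₁ (blockIndex-injective n {i} {j} {a} {b} eq)) i≢j
... | no  _  = ≡.refl

-- Ordered fields and the complex numbers over them.

module OrderedFieldProperties (𝓡 : CompleteOrderedField) where
  open CompleteOrderedField 𝓡 hiding (zero)
  open IsDecTotalOrder isDecTotalOrder using (total; antisym; ≤-respʳ-≈; ≤-respˡ-≈)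
    renaming (refl to ≤-refl; trans to ≤-trans)
  open RawSemiringOps (RawRing.rawSemiring rawRing) using () renaming (_×_ to _·_)
  open IntegerSolver commutativeRing
  open import Relation.Binary.Reasoning.Setoid setoid

  *-noZeroDivisors : ∀ {x y} → x ≉ 0# → x * y ≈ 0# → y ≈ 0#
  *-noZeroDivisors {x} {y} x≉0 xy≈0 = begin
    y                 ≈⟨ *-identityˡ y ⟨
    1# * y            ≈⟨ *-congʳ (⁻¹-inverseʳ x≉0) ⟨
    x * x ⁻¹ * y      ≈⟨ solve 3 (λ x i y → x :* i :* y := i :* (x :* y)) refl x (x ⁻¹) y ⟩
    x ⁻¹ * (x * y)    ≈⟨ *-congˡ xy≈0 ⟩
    x ⁻¹ * 0#         ≈⟨ zeroʳ _ ⟩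
    0#                ∎

  0≤x*x : ∀ x → 0# ≤ x * x
  0≤x*x x with total 0# x
  ... | inj₁ 0≤x = *-nonNegative 0≤x 0≤x
  ... | inj₂ x≤0 = ≤-respʳ-≈ (solve 1 (λ x → :- x :* :- x := x :* x) refl x)
      (*-nonNegative 0≤-x 0≤-x)
    where
    0≤-x : 0# ≤ - x
    0≤-x = ≤-respˡ-≈ (-‿inverseˡ x) (≤-respʳ-≈ (+-identityʳ _) (+-monoʳ-≤ (- x) x≤0))

  -- Squares are nonnegative, so x * x lies between 0 and the vanishing sum. This makes |z|² nonzero
  -- for nonzero complex z.
  x*x+y*y≈0⇒x≈0 : ∀ {x y} → x * x + y * y ≈ 0# → x ≈ 0#
  x*x+y*y≈0⇒x≈0 {x} {y} eq with x ≟ 0#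
  ... | yes x≈0 = x≈0
  ... | no  x≉0 = *-noZeroDivisors x≉0 (antisym
    (≤-respʳ-≈ eq (≤-respˡ-≈ (+-identityʳ _) (+-monoʳ-≤ (x * x) (0≤x*x y)))) (0≤x*x x))

  0≤1 : 0# ≤ 1#
  0≤1 = ≤-respʳ-≈ (*-identityˡ 1#) (0≤x*x 1#)

  1≤1+x : ∀ {x} → 0# ≤ x → 1# ≤ 1# + x
  1≤1+x 0≤x = ≤-respˡ-≈ (+-identityʳ 1#) (+-monoʳ-≤ 1# 0≤x)

  0≤n·1 : ∀ n → 0# ≤ n · 1#
  0≤n·1 zero    = ≤-refl
  0≤n·1 (suc n) = ≤-trans 0≤1 (1≤1+x (0≤n·1 n))

  -- A positive multiple of 1 is at least 1. This is what makes the average over the rows of a block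
  -- a genuine division.
  n·1≉0 : ∀ {n} → 1 ℕ.≤ n → n · 1# ≉ 0#
  n·1≉0 {suc n} _ eq = 0≉1 (antisym 0≤1 (≤-respʳ-≈ eq (1≤1+x (0≤n·1 n))))

module ComplexField (𝓡 : CompleteOrderedField) where
  open CompleteOrderedField 𝓡 hiding (zero)
  open Spectra 𝓡
  open OrderedFieldProperties 𝓡
  open IntegerSolver commutativeRing
  open import Relation.Binary.Reasoning.Setoid setoid
  open RawRing ℂ-rawRing using () renaming (_+_ to _+ℂ_; _*_ to _*ℂ_; 0# to 0ℂ; 1# to 1ℂ)

  private
    *ℂ-comm : ∀ z w → z *ℂ w ≈ℂ w *ℂ z
    *ℂ-comm (a +i b) (c +i d) =
      solve 4 (λ a b c d → a :* c :- b :* d := c :* a :- d :* b) refl a b c d ,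
      solve 4 (λ a b c d → a :* d :+ b :* c := c :* b :+ d :* a) refl a b c d

    *ℂ-identityˡ : ∀ z → 1ℂ *ℂ z ≈ℂ z
    *ℂ-identityˡ (a +i b) =
      trans (solve 4 (λ o x a b → o :* a :- x :* b := o :* a :+ x :* :- b) refl 1# 0# a b)
          (simplify a (- b)) ,
      simplify b a
      where
      simplify : ∀ x y → 1# * x + 0# * y ≈ x
      simplify x y = trans (+-cong (*-identityˡ x) (zeroˡ y)) (+-identityʳ x)

    *ℂ-distribˡ : ∀ u z w → u *ℂ (z +ℂ w) ≈ℂ u *ℂ z +ℂ u *ℂ w
    *ℂ-distribˡ (e +i f) (a +i b) (c +i d) =
      solve 6 (λ a b c d e f → e :* (a :+ c) :- f :* (b :+ d) := (e :* a :- f :* b) :+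
          (e :* c :- f :* d)) refl a b c d e f ,
      solve 6 (λ a b c d e f → e :* (b :+ d) :+ f :* (a :+ c) := (e :* b :+ f :* a) :+
          (e :* d :+ f :* c)) refl a b c d e f

    *ℂ-assoc : ∀ u z w → (u *ℂ z) *ℂ w ≈ℂ u *ℂ (z *ℂ w)
    *ℂ-assoc (e +i f) (a +i b) (c +i d) =
      solve 6 (λ a b c d e f → (e :* a :- f :* b) :* c :- (e :* b :+ f :* a) :* d
          := e :* (a :* c :- b :* d) :- f :* (a :* d :+ b :* c)) refl a b c d e f ,
      solve 6 (λ a b c d e f → (e :* a :- f :* b) :* d :+ (e :* b :+ f :* a) :* c
          := e :* (a :* d :+ b :* c) :+ f :* (a :* c :- b :* d)) refl a b c d e f

    ≈ℂ-trans : ∀ {u z w} → u ≈ℂ z → z ≈ℂ w → u ≈ℂ w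
    ≈ℂ-trans (p , q) (r , s) = trans p r , trans q s

    *ℂ-cong : ∀ {u u′ z z′} → u ≈ℂ u′ → z ≈ℂ z′ → u *ℂ z ≈ℂ u′ *ℂ z′
    *ℂ-cong (p , q) (r , s) = +-cong (*-cong p r) (-‿cong (*-cong q s)) , +-cong (*-cong p s)
        (*-cong q r)

    *ℂ-distribʳ : ∀ u z w → (z +ℂ w) *ℂ u ≈ℂ z *ℂ u +ℂ w *ℂ u
    *ℂ-distribʳ (e +i f) (a +i b) (c +i d) =
      solve 6 (λ a b c d e f → (a :+ c) :* e :- (b :+ d) :* f := (a :* e :- b :* f) :+
          (c :* e :- d :* f)) refl a b c d e f ,
      solve 6 (λ a b c d e f → (a :+ c) :* f :+ (b :+ d) :* e := (a :* f :+ b :* e) :+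
          (c :* f :+ d :* e)) refl a b c d e f

  ℂ-commutativeRing : CommutativeRing 0ℓ 0ℓ
  ℂ-commutativeRing = record
    { RawRing ℂ-rawRing
    ; isCommutativeRing = record
      { isRing = record
        { +-isAbelianGroup = record
          { isGroup = record
            { isMonoid = record
              { isSemigroup = record
                { isMagma = record
                  { isEquivalence = record
                    { refl  = refl , refl
                    ; sym   = λ (p , q) → sym p , sym q
                    ; trans = λ {u} {z} {w} → ≈ℂ-trans {u} {z} {w} }
                  ; ∙-cong = λ (p , q) (r , s) → +-cong p r , +-cong q s }
                ; assoc = λ u z w → +-assoc _ _ _ , +-assoc _ _ _ }
              ; identity =
                  (λ z → +-identityˡ _ , +-identityˡ _) ,
                  λ z → +-identityʳ _ , +-identityʳ _ }
            ; inverse = (λ z → -‿inverseˡ _ , -‿inverseˡ _) , λ z → -‿inverseʳ _ , -‿inverseʳ _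
            ; ⁻¹-cong = λ (p , q) → -‿cong p , -‿cong q }
          ; comm = λ z w → +-comm _ _ , +-comm _ _ }
        ; *-cong = λ {u} {u′} {z} {z′} → *ℂ-cong {u} {u′} {z} {z′}
        ; *-assoc = *ℂ-assoc
        ; *-identity = *ℂ-identityˡ , λ z → ≈ℂ-trans {z *ℂ 1ℂ} {1ℂ *ℂ z} {z} (*ℂ-comm z 1ℂ)
            (*ℂ-identityˡ z)
        ; distrib = *ℂ-distribˡ , *ℂ-distribʳ }
      ; *-comm = *ℂ-comm } }

  -- Multiplying by the conjugate of z reduces the claim to the real number |z|².
  *ℂ-noZeroDivisors : ∀ z w → ¬ z ≈ℂ 0ℂ → z *ℂ w ≈ℂ 0ℂ → w ≈ℂ 0ℂ
  *ℂ-noZeroDivisors (a +i b) (c +i d) z≉0 (re≈0 , im≈0) =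
    *-noZeroDivisors norm≉0 (begin
      (a * a + b * b) * c
        ≈⟨ solve 4 (λ a b c d → (a :* a :+ b :* b) :* c := a :* (a :* c :- b :* d) :+ b :*
            (a :* d :+ b :* c)) refl a b c d ⟩
      a * (a * c - b * d) + b * (a * d + b * c)      ≈⟨ vanish a b re≈0 im≈0 ⟩
      0#                                             ∎) ,
    *-noZeroDivisors norm≉0 (begin
      (a * a + b * b) * d
        ≈⟨ solve 4 (λ a b c d → (a :* a :+ b :* b) :* d := a :* (a :* d :+ b :* c) :+ :- b :*
            (a :* c :- b :* d)) refl a b c d ⟩
      a * (a * d + b * c) + - b * (a * c - b * d)    ≈⟨ vanish a (- b) im≈0 re≈0 ⟩
      0#                                             ∎)
    where
    norm≉0 : a * a + b * b ≉ 0#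
    norm≉0 eq = z≉0 (x*x+y*y≈0⇒x≈0 eq , x*x+y*y≈0⇒x≈0 (trans (+-comm _ _) eq))
    vanish : ∀ x y {u v} → u ≈ 0# → v ≈ 0# → x * u + y * v ≈ 0#
    vanish x y u≈0 v≈0 = trans
        (+-cong (trans (*-congˡ u≈0) (zeroʳ x)) (trans (*-congˡ v≈0) (zeroʳ y))) (+-identityʳ 0#)

  0ℂ≉1ℂ : ¬ 0ℂ ≈ℂ 1ℂ
  0ℂ≉1ℂ (0≈1 , _) = 0≉1 0≈1

-- The characteristic polynomial and the spectrum of the block matrix.

module BlockMatrix (𝓡 : CompleteOrderedField) where
  open CompleteOrderedField 𝓡 hiding (zero)
  open Spectra 𝓡
  open OrderedFieldProperties 𝓡
  open ComplexField 𝓡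
  open Determinants commutativeRing using (sum-zero)
  open Polynomials ℂ-rawRing
  open Roots _≟ℂ_
  open PolynomialRing ℂ-commutativeRing
  open LinearFactors ℂ-commutativeRing
  open LeadingCoefficients ℂ-commutativeRing using (charPoly-nonzero)
  open Multiplicities _≟ℂ_ *ℂ-noZeroDivisors 0ℂ≉1ℂ
  open RawSemiringOps (RawRing.rawSemiring rawRing) using (sum) renaming (_×_ to _·_)
  open RawSemiringOps (RawRing.rawSemiring polyRawRing) using (product; _^_)
    renaming (_×_ to _·ᴾ_)
  open Algebra.Properties.Monoid.Sum +-monoid using (sum-cong-≋; sum-replicate)
  open Algebra.Properties.CommutativeMonoid.Sum +-commutativeMonoid using (∑-distrib-+)
  open Algebra.Properties.Semiring.Sum semiring using (*-distribˡ-sum)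
  open Algebra.Properties.Semiring.Mult semiring using (×-assoc-*; ×-congʳ)
  module P = CommutativeRing ≋-commutativeRing
  module Mᴾ = MatrixOps polyRawRing

  sum-I-row : ∀ {n} (a : Fin n) → sum (λ b → I a b) ≈ 1#
  sum-I-row {suc n} zero    = trans (+-congˡ (sum-zero {n} (λ b → 0#) λ b → refl)) (+-identityʳ 1#)
  sum-I-row {suc n} (suc a) = trans (+-identityˡ _)
      (trans (sum-cong-≋ λ b → reflexive (≡.cong (if_then 1# else 0#) (⌊suc≟suc⌋ a b)))
      (sum-I-row a))

  -- Within block (i , j) a row of the large identity meets the diagonal once if i = j and never
  -- otherwise.
  sum-I-block : ∀ {t} (n : Fin t → ℕ) i j a →
                sum (λ b → I (blockIndex n i a) (blockIndex n j b)) ≈ I i j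
  sum-I-block n i j a with i ≟ᶠ j
  ... | yes ≡.refl = trans
      (sum-cong-≋ λ b → reflexive (≡.cong (if_then 1# else 0#) (⌊blockIndex≟blockIndex⌋ n i a b)))
      (sum-I-row a)
  ... | no i≢j = sum-zero (λ b → I (blockIndex n i a) (blockIndex n j b)) λ b → reflexive
      (≡.cong (if_then 1# else 0#) (⌊blockIndex≟blockIndex⌋-distinct n a b i≢j))

  averageRowSum-constant : ∀ {m n} (A : Matrix ℝ m n) y → 1 ℕ.≤ m →
    (∀ a → sum (λ b → A a b) ≈ y) → averageRowSum A ≈ y
  averageRowSum-constant {m} A y 1≤m rows = begin
    (sum λ a → sum λ b → A a b) * (m · 1#) ⁻¹
      ≈⟨ *-congʳ (trans (sum-cong-≋ rows) (sum-replicate m)) ⟩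
    (m · y) * (m · 1#) ⁻¹
      ≈⟨ *-congʳ (trans (×-assoc-* m 1# y) (×-congʳ m (*-identityˡ y))) ⟨
    (m · 1#) * y * (m · 1#) ⁻¹
      ≈⟨ solve 3 (λ x y z → x :* y :* z := y :* (x :* z)) refl (m · 1#) y _ ⟩
    y * ((m · 1#) * (m · 1#) ⁻¹)                 ≈⟨ *-congˡ (⁻¹-inverseʳ (n·1≉0 1≤m)) ⟩
    y * 1#                                       ≈⟨ *-identityʳ y ⟩
    y                                            ∎
    where
    open import Relation.Binary.Reasoning.Setoid setoid
    open IntegerSolver commutativeRing

  ι : ℝ → Poly
  ι x = C (fromℝ x)

  ι-cong : ∀ {x y} → x ≈ y → ι x ≋ ι y
  ι-cong e = ∷-cong (e , refl) ≋-refl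

  ι-+ : ∀ x y → ι (x + y) ≋ ι x +ᴾ ι y
  ι-+ x y = ∷-cong (refl , sym (+-identityʳ 0#)) ≋-refl

  ι-0 : ι 0# ≋ []
  ι-0 = 0∷[]≋[]

  -- Reconciles two multiples: the quotient matrix has `n j` copies added up in ℝ, the merged
  -- determinant has them added up as polynomials.
  ι-neg-· : ∀ n x → negᴾ (ι (n · x)) ≋ n ·ᴾ negᴾ (ι x)
  ι-neg-· zero    x = ≋-trans (negᴾ-cong ι-0) ≋-refl
  ι-neg-· (suc n) x = ≋-trans (negᴾ-cong (ι-+ x (n · x)))
    (≋-trans (solve 2 (λ x y → :- (x :+ y) := :- x :+ :- y) ≋-refl (ι x) (ι (n · x)))
      (+ᴾ-congˡ (negᴾ (ι x)) (ι-neg-· n x)))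
    where open IntegerSolver ≋-commutativeRing

  -- Serves both matrices: M with y = T i j, and its quotient with y = n j · T i j. The diagonal
  -- test is an arbitrary Boolean because the two have different index sets.
  charPoly-entry : ∀ x y q (b : Bool) → x ≈ y + q * (if b then 1# else 0#) →
    X *ᴾ (if b then P.1# else []) +ᴾ negᴾ (ι x) ≋
    negᴾ (ι y) +ᴾ linear (fromℝ q) *ᴾ (if b then P.1# else [])
  charPoly-entry x y q b x≈ = begin
    X *ᴾ δ +ᴾ negᴾ (ι x)
      ≈⟨ +ᴾ-congˡ (X *ᴾ δ) (negᴾ-cong (≋-trans (ι-cong x≈) (ι-affine b))) ⟩
    X *ᴾ δ +ᴾ negᴾ (ι y +ᴾ ι q *ᴾ δ)
      ≈⟨ solve 4 (λ x y q d → x :* d :+ :- (y :+ q :* d) := :- y :+ (x :+ :- q) :* d) ≋-refl X (ι y)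
          (ι q) δ ⟩
    negᴾ (ι y) +ᴾ linear (fromℝ q) *ᴾ δ              ∎
    where
    open IntegerSolver ≋-commutativeRing
    open import Relation.Binary.Reasoning.Setoid ≋-setoid
    δ = if b then P.1# else []
    ι-affine : ∀ b → ι (y + q * (if b then 1# else 0#)) ≋ ι y +ᴾ ι q *ᴾ (if b then P.1# else [])
    ι-affine true  = ≋-trans (ι-cong (+-congˡ (*-identityʳ q)))
        (≋-trans (ι-+ y q) (+ᴾ-congˡ (ι y) (≋-sym (P.*-identityʳ (ι q)))))
    ι-affine false = ≋-trans (ι-cong (trans (+-congˡ (zeroʳ q)) (+-identityʳ y)))
        (≋-sym (≋-trans (+ᴾ-congˡ (ι y) (*ᴾ-zeroʳ (ι q))) (+ᴾ-identityʳ (ι y))))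

  multiplicity-^ : ∀ {z p} m → Multiplicity z 1 p → Multiplicity z m (p ^ m)
  multiplicity-^ zero    h = multiplicity-1 _
  multiplicity-^ (suc m) h = multiplicity-* h (multiplicity-^ m h)

  multiplicity-0-^ : ∀ {z p} m → Multiplicity z 0 p → Multiplicity z 0 (p ^ m)
  multiplicity-0-^ zero    h = multiplicity-1 _
  multiplicity-0-^ (suc m) h = multiplicity-* h (multiplicity-0-^ m h)

  multiplicity-linear-^ : ∀ z w m → Multiplicity z ((w [ m ]) z) (linear w ^ m)
  multiplicity-linear-^ z w m with w ≟ℂ z
  ... | yes w≈z = multiplicity-^ m (multiplicity-linear-root w≈z)
  ... | no  w≉z = multiplicity-0-^ m (multiplicity-linear-nonroot w≉z)

  multiplicity-product : ∀ {t z} (m : Fin t → ℕ) (p : Fin t → Poly) →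
    (∀ i → Multiplicity z (m i) (p i)) → Multiplicity z (sumℕ m) (product p)
  multiplicity-product {zero}  m p h = multiplicity-1 _
  multiplicity-product {suc t} m p h = multiplicity-* (h zero) (multiplicity-product _ _ (h ∘ suc))

  module _ {t} (n : Fin t → ℕ) (1≤n : ∀ i → 1 ℕ.≤ n i) (M : Matrix ℝ (sumℕ n) (sumℕ n))
    (T : Fin t → Fin t → ℝ) (p : Fin t → ℝ)
    (M≈ : ∀ i a j b → M (blockIndex n i a) (blockIndex n j b) ≈
                      T i j + p i * I (blockIndex n i a) (blockIndex n j b)) where

    -- All rows of block (i , j) have the same sum, so the average equals it: `n j` copies of T i j,
    -- plus p i if the block is diagonal.
    quotientMatrix≈ : ∀ i j → quotientMatrix n M i j ≈ n j · T i j + p i * I i j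
    quotientMatrix≈ i j = averageRowSum-constant (block n M i j) _ (1≤n i) λ a → begin
      sum (λ b → M (blockIndex n i a) (blockIndex n j b))
        ≈⟨ sum-cong-≋ (λ b → M≈ i a j b) ⟩
      sum (λ b → T i j + p i * I (blockIndex n i a) (blockIndex n j b))
        ≈⟨ ∑-distrib-+ (λ b → T i j) (λ b → p i * I (blockIndex n i a) (blockIndex n j b)) ⟩
      sum {n j} (λ b → T i j) + sum (λ b → p i * I (blockIndex n i a) (blockIndex n j b))
        ≈⟨ +-cong (sum-replicate (n j))
            (trans (sym (*-distribˡ-sum (p i) (λ b → I (blockIndex n i a) (blockIndex n j b))))
            (*-congˡ (sum-I-block n i j a))) ⟩
      n j · T i j + p i * I i j ∎
      where open import Relation.Binary.Reasoning.Setoid setoid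

    complex : ∀ {m} → Matrix ℝ m m → Matrix ℂ m m
    complex A i j = fromℝ (A i j)

    S : Fin t → Fin t → Poly
    S i j = negᴾ (ι (T i j))

    d : Fin t → Poly
    d i = linear (fromℝ (p i))

    -- X I - M and X I - B have the same off-diagonal shape and the same diagonal terms X - p i, so
    -- they are the uncollapsed and the collapsed matrix for the same `S` and `d`, up to the form of
    -- the entries.
    charPoly-factorisation : charPoly (complex M) ≋
      product (λ i → d i ^ (n i ∸ 1)) *ᴾ charPoly (complex (quotientMatrix n M))
    charPoly-factorisation = begin
      charPoly (complex M)
        ≈⟨ mk≋ (det-blocks polyCommutativeRing n 1≤n S d (λ x y → X *ᴾ Mᴾ.I x y +ᴾ negᴾ (ι (M x y)))
             λ i a j b → at
                 (charPoly-entry _ (T i j) (p i) ⌊ blockIndex n i a ≟ᶠ blockIndex n j b ⌋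
                 (M≈ i a j b))) ⟩
      product (λ i → d i ^ (n i ∸ 1)) *ᴾ Mᴾ.det collapsedMatrix
        ≈⟨ *ᴾ-congˡ (product (λ i → d i ^ (n i ∸ 1)))
             (mk≋ (Determinants.det-cong polyCommutativeRing {A = charMatrix} {B = collapsedMatrix}
                 λ i j → at (entry i j))) ⟨
      product (λ i → d i ^ (n i ∸ 1)) *ᴾ charPoly (complex (quotientMatrix n M)) ∎
      where
      open import Relation.Binary.Reasoning.Setoid ≋-setoid
      collapsedMatrix charMatrix : Matrix Poly t t
      collapsedMatrix i j = n j ·ᴾ S i j +ᴾ d i *ᴾ Mᴾ.I i j
      charMatrix i j = X *ᴾ Mᴾ.I i j +ᴾ negᴾ (ι (quotientMatrix n M i j))
      entry : ∀ i j → charMatrix i j ≋ collapsedMatrix i j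
      entry i j = ≋-trans (charPoly-entry _ (n j · T i j) (p i) ⌊ i ≟ᶠ j ⌋ (quotientMatrix≈ i j))
        (+ᴾ-congʳ (d i *ᴾ Mᴾ.I i j) (ι-neg-· (n j) (T i j)))

    -- The roots of the characteristic polynomial of B are never located: its computed multiplicity
    -- at z is itself certified and enters the product as it stands.
    spectrum : σ M ≗ σ (quotientMatrix n M) ∪ ⋃ (λ i → fromℝ (p i) [ n i ∸ 1 ])
    spectrum z = ≡.trans
      (rootMultiplicity-unique charPoly-factorisation (multiplicity-*
        (multiplicity-product _ _ λ i → multiplicity-linear-^ z (fromℝ (p i)) (n i ∸ 1))
        (rootMultiplicity-multiplicity z (charPoly B) (charPoly-nonzero 0ℂ≉1ℂ B))))
      -- The factorisation has the powers of X - p i first, the union has the quotient matrix first.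
      (ℕ.+-comm (sumℕ λ i → (fromℝ (p i) [ n i ∸ 1 ]) z) (σ (quotientMatrix n M) z))
      where B = complex (quotientMatrix n M)

open import Data.Nat.Base using (_≤_)

lemma3p3 : (𝓡 : CompleteOrderedField) → let open Spectra 𝓡 in
    (t : ℕ) → 1 ≤ t →
    (n : Fin t → ℕ) → (∀ i → 1 ≤ n i) →
    (M : Matrix ℝ (sumℕ n) (sumℕ n)) →
    (l p : Fin t → ℝ) (s : Fin t → Fin t → ℝ) →
    (∀ i → block n M i i ≈ᴹ l i • J +ᴹ p i • I) →
    (∀ i j → i ≢ j → block n M i j ≈ᴹ s i j • J) →
    σ M ≗ σ (quotientMatrix n M) ∪ ⋃ (λ i → fromℝ (p i) [ n i ∸ 1 ])
lemma3p3 𝓡 t 1≤t n 1≤n M l p s Mᵢᵢ Mᵢⱼ = BlockMatrix.spectrum 𝓡 n 1≤n M T p M≈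
  where
  open CompleteOrderedField 𝓡 hiding (_≤_; zero)
  open Spectra 𝓡
  -- One coefficient of J for all blocks. The term p i I can then be added off the diagonal too,
  -- since the large identity vanishes between distinct blocks.
  T : Fin t → Fin t → ℝ
  T i j = if ⌊ i ≟ᶠ j ⌋ then l i else s i j
  M≈ : ∀ i a j b → M (blockIndex n i a) (blockIndex n j b) ≈
                   T i j + p i * I (blockIndex n i a) (blockIndex n j b)
  M≈ i a j b with i ≟ᶠ j
  ... | yes ≡.refl rewrite ⌊blockIndex≟blockIndex⌋ n i a b = trans (Mᵢᵢ i a b)
      (+-congʳ (*-identityʳ _))
  ... | no i≢j rewrite ⌊blockIndex≟blockIndex⌋-distinct n a b i≢j = trans (Mᵢⱼ i j i≢j a b)
    (trans (*-identityʳ _) (sym (trans (+-congˡ (zeroʳ _)) (+-identityʳ _))))
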